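{- Let ${\cal P}={\cal P}_{in}\cup{\cal P}_{out}$, let $\gamma$ be an assumption formula and $\varphi$ a co-safety LTL formula over ${\cal P}$. The formula $\gamma\rightarrow\varphi$ is tightly realisable if and only if it is realisable. Moreover, a Mealy machine tightly realising $\gamma\rightarrow\varphi$ can be constructed from a Mealy machine realising $\gamma\rightarrow\varphi$ within the same (2EXPTIME) complexity as LTL realisability.
   Context: LTL over ${\cal P}$: $\phi ::= \mathit{tt}\mid\mathit{ff}\mid e\mid\neg e\mid\phi\wedge\phi\mid\phi\vee\phi\mid X\phi\mid\phi U\phi\mid G\phi$ with standard infinite-trace semantics; co-safety LTL is the fragment without $G$. Finite-trace semantics of a co-safety formula on $u=u_0\cdots u_{n}$ (written for sub-traces $\sigma_{i,j}$, $j<\infty$): atoms and Boolean connectives at position $i$; $\sigma_{i,j}\vdash X\varphi$ iff $j>i$ and $\sigma_{i+1,j}\vdash\varphi$; $\sigma_{i,j}\vdash\varphi U\psi$ iff some $l\in[i,j]$ has $\sigma_{l,j}\vdash\psi$ and $\sigma_{k,j}\vdash\varphi$ for all $k\in[i,l)$. Tight satisfaction: $\sigma_{i,j}\Vdash\varphi$ iff $\sigma_{i,j}\vdash\varphi$ and $\sigma_{i,k}\not\vdash\varphi$ for all $i\le k<j$. Assumption formulas: $\alpha ::= \mathit{tt}\mid\mathit{ff}\mid a\mid\neg\alpha\mid\alpha\wedge\alpha\mid\alpha\vee\alpha$ ($a\in{\cal P}$); $\beta ::= \alpha\mid X\alpha\mid\beta\wedge\beta\mid\beta\vee\beta$; $\gamma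 ::= G\beta\mid GF\alpha\mid\gamma\wedge\gamma$. A Mealy machine is $C=\langle S,s_0,\Sigma_{in},\Sigma_{out},\rightarrow,F\rangle$ with states $S$, initial state $s_0$, $\Sigma_{in}=2^{{\cal P}_{in}}$, $\Sigma_{out}=2^{{\cal P}_{out}}$, complete deterministic transition function $\rightarrow:S\times\Sigma_{in}\to\Sigma_{out}\times S$ (written $s\xrightarrow{I/O}s'$), and accepting states $F\subseteq S$. A run $s_0s_1\cdots$ with $s_i\xrightarrow{I_i/O_i}s_{i+1}$ produces the word $w=\sigma_0\sigma_1\cdots$ with $\sigma_i=I_i\cup O_i$; $C$ accepts a prefix $u$ of $w$ if $s_{|u|}\in F$. $C$ realises an LTL formula if every word it produces satisfies it; a formula is realisable if some Mealy machine realises it. $C$ tightly realises $\gamma\rightarrow\varphi$ if it realises $\gamma\rightarrow\varphi$ and, for every word $w$ produced by $C$ with $w\vdash\gamma$, there is a prefix $u$ of $w$ such that $C$ accepts $u$, $u$ tightly satisfies $\varphi$, and $C$ accepts no strict prefix $u'$ of $u$. -}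

module Defs where

open import Data.Bool using (Bool; true; false)
open import Data.Empty using (⊥)
open import Data.Fin using (Fin; toℕ)
open import Data.Fin.Subset using (Subset; inside; outside; _∈_; _∉_; _∪_; ∣_∣)
open import Data.Nat using (ℕ; zero; suc; _+_; _*_; _^_; _≤_; _<_)
open import Data.Product using (Σ; ∃-syntax; _×_; _,_)
open import Data.Sum using (_⊎_)
open import Data.Unit using (⊤)
open import Data.Vec using (Vec; []; _∷_; lookup; tabulate)
open import Relation.Binary.PropositionalEquality using (_≡_)
open import Relation.Nullary using (¬_)

------------------------------------------------------------------------
-- Traces over 𝒫 = Fin k

Letter : ℕ → Set
Letter k = Subset k

Trace : ℕ → Set
Trace k = ℕ → Letter k

------------------------------------------------------------------------
-- Co-safety LTL

infixr 7 _∧_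
infixr 6 _∨_
infixr 8 _U_

data CoSafety (k : ℕ) : Set where
  tt ff   : CoSafety k
  atom    : Fin k → CoSafety k
  ¬atom   : Fin k → CoSafety k
  _∧_ _∨_ : CoSafety k → CoSafety k → CoSafety k
  X       : CoSafety k → CoSafety k
  _U_     : CoSafety k → CoSafety k → CoSafety k

-- σ , i ⊢ φ : the infinite suffix σᵢ σᵢ₊₁ ⋯ satisfies φ.
infix 4 _,_⊢_

_,_⊢_ : ∀ {k} → Trace k → ℕ → CoSafety k → Set
σ , i ⊢ tt      = ⊤
σ , i ⊢ ff      = ⊥
σ , i ⊢ atom e  = e ∈ σ i
σ , i ⊢ ¬atom e = e ∉ σ i
σ , i ⊢ φ ∧ ψ   = σ , i ⊢ φ × σ , i ⊢ ψ
σ , i ⊢ φ ∨ ψ   = σ , i ⊢ φ ⊎ σ , i ⊢ ψ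
σ , i ⊢ X φ     = σ , suc i ⊢ φ
σ , i ⊢ φ U ψ   =
  ∃[ l ] i ≤ l × σ , l ⊢ ψ × (∀ m → i ≤ m → m < l → σ , m ⊢ φ)

-- σ [ i ⋯ j ]⊢ φ : the finite sub-trace σᵢ ⋯ σⱼ (both ends included)
-- satisfies φ.
infix 4 _[_⋯_]⊢_ _[_⋯_]⊩_

_[_⋯_]⊢_ : ∀ {k} → Trace k → ℕ → ℕ → CoSafety k → Set
σ [ i ⋯ j ]⊢ tt      = ⊤
σ [ i ⋯ j ]⊢ ff      = ⊥
σ [ i ⋯ j ]⊢ atom e  = e ∈ σ i
σ [ i ⋯ j ]⊢ ¬atom e = e ∉ σ i
σ [ i ⋯ j ]⊢ φ ∧ ψ   = σ [ i ⋯ j ]⊢ φ × σ [ i ⋯ j ]⊢ ψ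
σ [ i ⋯ j ]⊢ φ ∨ ψ   = σ [ i ⋯ j ]⊢ φ ⊎ σ [ i ⋯ j ]⊢ ψ
σ [ i ⋯ j ]⊢ X φ     = i < j × σ [ suc i ⋯ j ]⊢ φ
σ [ i ⋯ j ]⊢ φ U ψ   =
  ∃[ l ] i ≤ l × l ≤ j × σ [ l ⋯ j ]⊢ ψ
       × (∀ m → i ≤ m → m < l → σ [ m ⋯ j ]⊢ φ)

_[_⋯_]⊩_ : ∀ {k} → Trace k → ℕ → ℕ → CoSafety k → Set
σ [ i ⋯ j ]⊩ φ =
  σ [ i ⋯ j ]⊢ φ × (∀ m → i ≤ m → m < j → ¬ (σ [ i ⋯ m ]⊢ φ))

------------------------------------------------------------------------
-- Assumption formulas: the grammars α, β and γ

data Alpha (k : ℕ) : Set where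
  tt ff   : Alpha k
  atom    : Fin k → Alpha k
  neg     : Alpha k → Alpha k
  _∧_ _∨_ : Alpha k → Alpha k → Alpha k

data Beta (k : ℕ) : Set where
  now     : Alpha k → Beta k
  X       : Alpha k → Beta k
  _∧_ _∨_ : Beta k → Beta k → Beta k

data Assumption (k : ℕ) : Set where
  G   : Beta k → Assumption k
  GF  : Alpha k → Assumption k
  _∧_ : Assumption k → Assumption k → Assumption k

infix 4 _,_⊢α_ _,_⊢β_ _,_⊢γ_

_,_⊢α_ : ∀ {k} → Trace k → ℕ → Alpha k → Set
σ , i ⊢α tt     = ⊤
σ , i ⊢α ff     = ⊥
σ , i ⊢α atom a = a ∈ σ i
σ , i ⊢α neg α  = ¬ (σ , i ⊢α α)
σ , i ⊢α α ∧ α′ = σ , i ⊢α α × σ , i ⊢α α′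
σ , i ⊢α α ∨ α′ = σ , i ⊢α α ⊎ σ , i ⊢α α′

_,_⊢β_ : ∀ {k} → Trace k → ℕ → Beta k → Set
σ , i ⊢β now α  = σ , i ⊢α α
σ , i ⊢β X α    = σ , suc i ⊢α α
σ , i ⊢β β ∧ β′ = σ , i ⊢β β × σ , i ⊢β β′
σ , i ⊢β β ∨ β′ = σ , i ⊢β β ⊎ σ , i ⊢β β′

_,_⊢γ_ : ∀ {k} → Trace k → ℕ → Assumption k → Set
σ , i ⊢γ G β    = ∀ j → i ≤ j → σ , j ⊢β β
σ , i ⊢γ GF α   = ∀ j → i ≤ j → ∃[ l ] j ≤ l × σ , l ⊢α α
σ , i ⊢γ γ ∧ γ′ = σ , i ⊢γ γ × σ , i ⊢γ γ′

------------------------------------------------------------------------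
-- Mealy machines

-- 2^p for p ⊆ 𝒫, each element given by one bit per element of p.
Sub : ∀ {k} → Subset k → Set
Sub p = Subset ∣ p ∣

embed : ∀ {k} (p : Subset k) → Sub p → Subset k
embed []            []      = []
embed (outside ∷ p) I       = outside ∷ embed p I
embed (inside  ∷ p) (b ∷ I) = b ∷ embed p I

record Mealy {k : ℕ} (Pin Pout : Subset k) : Set where
  field
    states : ℕ
    start  : Fin states
    trans  : Fin states → Sub Pin → Sub Pout × Fin states
    final  : Subset states

module _ {k : ℕ} {Pin Pout : Subset k} where

  record Run (C : Mealy Pin Pout) : Set where
    open Mealy C
    field
      state   : ℕ → Fin states
      input   : ℕ → Sub Pin
      output  : ℕ → Sub Pout
      initial : state 0 ≡ start
      step    : ∀ i → trans (state i) (input i) ≡ (output i , state (suc i))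

    word : Trace k
    word i = embed Pin (input i) ∪ embed Pout (output i)

    -- The prefix of the word of length n is accepted.
    Accepts : ℕ → Set
    Accepts n = state n ∈ final

  _Realises_⟶_ : Mealy Pin Pout → Assumption k → CoSafety k → Set
  C Realises γ ⟶ φ = (r : Run C) → let open Run r in
    word , 0 ⊢γ γ → word , 0 ⊢ φ

  -- The prefix u is σ₀ ⋯ σₙ, of length suc n; its strict prefixes are those
  -- of length m ≤ n, the empty one included.
  _TightlyRealises_⟶_ : Mealy Pin Pout → Assumption k → CoSafety k → Set
  C TightlyRealises γ ⟶ φ = C Realises γ ⟶ φ ×
    ((r : Run C) → let open Run r in
      word , 0 ⊢γ γ →
      ∃[ n ] Accepts (suc n) × word [ 0 ⋯ n ]⊩ φ × (∀ m → m ≤ n → ¬ Accepts m))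

Realisable : ∀ {k} (Pin Pout : Subset k) → Assumption k → CoSafety k → Set
Realisable Pin Pout γ φ = Σ (Mealy Pin Pout) λ C → C Realises γ ⟶ φ

TightlyRealisable : ∀ {k} (Pin Pout : Subset k) → Assumption k → CoSafety k → Set
TightlyRealisable Pin Pout γ φ = Σ (Mealy Pin Pout) λ C → C TightlyRealises γ ⟶ φ

------------------------------------------------------------------------
-- Model of computation: first-order recursive functional programs over
-- binary trees (pure Lisp), with the number of evaluation steps as running
-- time.  The model is Turing-complete.  Steps are constant-time pointer
-- operations, so running times agree with those of Turing machines up to a
-- polynomial, provided the size of the result, which may share subtrees, is
-- bounded as well.

infixr 5 _∙_

data Tree : Set where
  nil : Tree
  _∙_ : Tree → Tree → Tree

size : Tree → ℕ
size nil     = 1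
size (s ∙ t) = suc (size s + size t)

-- Expressions with n free variables over functions of the given arities.
data Expr {f : ℕ} (arity : Fin f → ℕ) (n : ℕ) : Set where
  var  : Fin n → Expr arity n
  nil  : Expr arity n
  cons : Expr arity n → Expr arity n → Expr arity n
  -- case e of { nil → e₁ ; x₀ ∙ x₁ → e₂ }, where e₂ refers to x₀ and x₁ as
  -- variables 0 and 1.
  case : Expr arity n → Expr arity n → Expr arity (suc (suc n)) → Expr arity n
  call : (g : Fin f) → Vec (Expr arity n) (arity g) → Expr arity n

record Program (inputs : ℕ) : Set where
  field
    functions : ℕ
    arity     : Fin functions → ℕ
    body      : (g : Fin functions) → Expr arity (arity g)
    main      : Expr arity inputs

module Evaluation {f : ℕ} {arity : Fin f → ℕ}
                  (body : (g : Fin f) → Expr arity (arity g)) where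

  infix 4 _⊢_⇓_⟨_⟩ _⊢*_⇓_⟨_⟩

  mutual

    -- ρ ⊢ e ⇓ v ⟨ t ⟩ : in environment ρ, e evaluates to v in t steps.
    data _⊢_⇓_⟨_⟩ {n : ℕ} (ρ : Vec Tree n) :
                  Expr arity n → Tree → ℕ → Set where
      var⇓   : ∀ {x} → ρ ⊢ var x ⇓ lookup ρ x ⟨ 1 ⟩
      nil⇓   : ρ ⊢ nil ⇓ nil ⟨ 1 ⟩
      cons⇓  : ∀ {e₁ e₂ v₁ v₂ t₁ t₂} →
               ρ ⊢ e₁ ⇓ v₁ ⟨ t₁ ⟩ → ρ ⊢ e₂ ⇓ v₂ ⟨ t₂ ⟩ →
               ρ ⊢ cons e₁ e₂ ⇓ v₁ ∙ v₂ ⟨ suc (t₁ + t₂) ⟩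
      case⇓₁ : ∀ {e e₁ e₂ v t t₁} →
               ρ ⊢ e ⇓ nil ⟨ t ⟩ → ρ ⊢ e₁ ⇓ v ⟨ t₁ ⟩ →
               ρ ⊢ case e e₁ e₂ ⇓ v ⟨ suc (t + t₁) ⟩
      case⇓₂ : ∀ {e e₁ e₂ x y v t t₂} →
               ρ ⊢ e ⇓ x ∙ y ⟨ t ⟩ → (x ∷ y ∷ ρ) ⊢ e₂ ⇓ v ⟨ t₂ ⟩ →
               ρ ⊢ case e e₁ e₂ ⇓ v ⟨ suc (t + t₂) ⟩
      call⇓  : ∀ {g es vs v t t′} →
               ρ ⊢* es ⇓ vs ⟨ t ⟩ → vs ⊢ body g ⇓ v ⟨ t′ ⟩ →
               ρ ⊢ call g es ⇓ v ⟨ suc (t + t′) ⟩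

    data _⊢*_⇓_⟨_⟩ {n : ℕ} (ρ : Vec Tree n) :
                   ∀ {a} → Vec (Expr arity n) a → Vec Tree a → ℕ → Set where
      []⇓  : ρ ⊢* [] ⇓ [] ⟨ 0 ⟩
      _∷⇓_ : ∀ {a e v t t′} {es : Vec (Expr arity n) a} {vs : Vec Tree a} →
             ρ ⊢ e ⇓ v ⟨ t ⟩ → ρ ⊢* es ⇓ vs ⟨ t′ ⟩ →
             ρ ⊢* (e ∷ es) ⇓ (v ∷ vs) ⟨ t + t′ ⟩

infix 4 _on_yields_within_

_on_yields_within_ : ∀ {n} → Program n → Vec Tree n → Tree → ℕ → Set
P on vs yields v within b =
  (∃[ t ] t ≤ b × vs ⊢ main ⇓ v ⟨ t ⟩) × size v ≤ b
  where
  open Program P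
  open Evaluation body

------------------------------------------------------------------------
-- Encodings as trees

encℕ : ℕ → Tree
encℕ zero    = nil
encℕ (suc n) = nil ∙ encℕ n

encFin : ∀ {n} → Fin n → Tree
encFin i = encℕ (toℕ i)

encBool : Bool → Tree
encBool false = nil
encBool true  = nil ∙ nil

encVec : ∀ {A : Set} {n} → (A → Tree) → Vec A n → Tree
encVec enc []       = nil
encVec enc (x ∷ xs) = enc x ∙ encVec enc xs

encSubset : ∀ {n} → Subset n → Tree
encSubset = encVec encBool

-- The table of a function on Subset n, as a complete binary decision tree
-- of depth n.
encTable : ∀ {A : Set} n → (A → Tree) → (Subset n → A) → Tree
encTable zero    enc f = enc (f [])
encTable (suc n) enc f =
  encTable n enc (λ I → f (outside ∷ I)) ∙ encTable n enc (λ I → f (inside ∷ I))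

encMealy : ∀ {k} {Pin Pout : Subset k} → Mealy Pin Pout → Tree
encMealy {Pin = Pin} {Pout} C =
  encSubset Pin ∙ encSubset Pout ∙ encℕ states ∙ encFin start ∙
  encVec (encTable ∣ Pin ∣ λ (O , s) → encSubset O ∙ encFin s) (tabulate trans) ∙
  encSubset final
  where open Mealy C

encCoSafety : ∀ {k} → CoSafety k → Tree
encCoSafety tt        = encℕ 0 ∙ nil
encCoSafety ff        = encℕ 1 ∙ nil
encCoSafety (atom e)  = encℕ 2 ∙ encFin e
encCoSafety (¬atom e) = encℕ 3 ∙ encFin e
encCoSafety (φ ∧ ψ)   = encℕ 4 ∙ encCoSafety φ ∙ encCoSafety ψ
encCoSafety (φ ∨ ψ)   = encℕ 5 ∙ encCoSafety φ ∙ encCoSafety ψ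
encCoSafety (X φ)     = encℕ 6 ∙ encCoSafety φ
encCoSafety (φ U ψ)   = encℕ 7 ∙ encCoSafety φ ∙ encCoSafety ψ

encAlpha : ∀ {k} → Alpha k → Tree
encAlpha tt       = encℕ 0 ∙ nil
encAlpha ff       = encℕ 1 ∙ nil
encAlpha (atom a) = encℕ 2 ∙ encFin a
encAlpha (neg α)  = encℕ 3 ∙ encAlpha α
encAlpha (α ∧ α′) = encℕ 4 ∙ encAlpha α ∙ encAlpha α′
encAlpha (α ∨ α′) = encℕ 5 ∙ encAlpha α ∙ encAlpha α′

encBeta : ∀ {k} → Beta k → Tree
encBeta (now α)  = encℕ 0 ∙ encAlpha α
encBeta (X α)    = encℕ 1 ∙ encAlpha α
encBeta (β ∧ β′) = encℕ 2 ∙ encBeta β ∙ encBeta β′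
encBeta (β ∨ β′) = encℕ 3 ∙ encBeta β ∙ encBeta β′

encAssumption : ∀ {k} → Assumption k → Tree
encAssumption (G β)    = encℕ 0 ∙ encBeta β
encAssumption (GF α)   = encℕ 1 ∙ encAlpha α
encAssumption (γ ∧ γ′) = encℕ 2 ∙ encAssumption γ ∙ encAssumption γ′

------------------------------------------------------------------------
-- Length of formulas, as the number of their symbols

lenCoSafety : ∀ {k} → CoSafety k → ℕ
lenCoSafety tt        = 1
lenCoSafety ff        = 1
lenCoSafety (atom e)  = 1
lenCoSafety (¬atom e) = 2
lenCoSafety (φ ∧ ψ)   = suc (lenCoSafety φ + lenCoSafety ψ)
lenCoSafety (φ ∨ ψ)   = suc (lenCoSafety φ + lenCoSafety ψ)
lenCoSafety (X φ)     = suc (lenCoSafety φ)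
lenCoSafety (φ U ψ)   = suc (lenCoSafety φ + lenCoSafety ψ)

lenAlpha : ∀ {k} → Alpha k → ℕ
lenAlpha tt       = 1
lenAlpha ff       = 1
lenAlpha (atom a) = 1
lenAlpha (neg α)  = suc (lenAlpha α)
lenAlpha (α ∧ α′) = suc (lenAlpha α + lenAlpha α′)
lenAlpha (α ∨ α′) = suc (lenAlpha α + lenAlpha α′)

lenBeta : ∀ {k} → Beta k → ℕ
lenBeta (now α)  = lenAlpha α
lenBeta (X α)    = suc (lenAlpha α)
lenBeta (β ∧ β′) = suc (lenBeta β + lenBeta β′)
lenBeta (β ∨ β′) = suc (lenBeta β + lenBeta β′)

lenAssumption : ∀ {k} → Assumption k → ℕ
lenAssumption (G β)    = suc (lenBeta β)
lenAssumption (GF α)   = suc (suc (lenAlpha α))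
lenAssumption (γ ∧ γ′) = suc (lenAssumption γ + lenAssumption γ′)

∣_⟶_∣ : ∀ {k} → Assumption k → CoSafety k → ℕ
∣ γ ⟶ φ ∣ = suc (lenAssumption γ + lenCoSafety φ)

-- poly(s) · 2^2^poly(l).  A machine obtained from the formula by a 2EXPTIME
-- synthesis procedure has size s at most 2^2^poly(l), so that a further
-- construction within this bound leaves the whole procedure in 2EXPTIME;
-- a bound 2^2^poly(s + l) would not.
doublyExponential : (c s l : ℕ) → ℕ
doublyExponential c s l = c * s ^ c * 2 ^ (2 ^ (c * l ^ c))

{-# OPTIONS --safe #-}

-- The truth values of all subformulas of φ on a finite trace are determined
-- by its first letter and their truth values on the rest; beyond the end of the
-- trace they are all false.  So φ holds on a₀ ⋯ aₙ iff (step a₀ ∘ ⋯ ∘ step aₙ)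
-- maps the all-false valuation to one that makes φ true.  A deterministic
-- monitor keeps the function v ↦ (step a₀ ∘ ⋯ ∘ step aₙ) v φ, of which there are
-- doubly exponentially many, composes it with step a on reading a, and accepts
-- when its value at the all-false valuation is true, that is, exactly when the
-- prefix read satisfies φ.  The product of C with this monitor produces the same
-- words as C, so a word satisfying γ satisfies φ, hence has a finite prefix
-- satisfying φ, and the shortest one is the first to be accepted.
--
-- For the complexity, the running time of a program is linear in the number of
-- calls, and these are bounded by a polynomial in s · 2^2^l.

module Submission where

open import Data.Bool as Bool using (Bool; true; false; not)
open import Data.Fin using (Fin; zero; suc; toℕ; combine; remQuot; #_; _↑ˡ_; _↑ʳ_)
open import Data.Fin.Properties using (remQuot-combine; toℕ-↑ˡ; toℕ-↑ʳ; toℕ<n)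
open import Data.Fin.Subset using (Subset; _∪_; ⊤; inside; outside; ∣_∣)
open import Data.List as List using (List; []; _∷_; length; map; cartesianProduct; cartesianProductWith; _++_; _ʳ++_)
open import Data.List.Membership.Propositional using (_∈_)
open import Data.List.Membership.Propositional.Properties using (∈-cartesianProduct⁺; ∈-cartesianProductWith⁺)
open import Data.List.Properties using (map-cong; length-ʳ++; length-++; length-map)
open import Data.List.Relation.Unary.Any using (here; there; tail)
open import Data.Nat using (ℕ; zero; suc; _+_; _*_; _^_; _≤_; _<_; z≤n; s≤s; s≤s⁻¹; _⊔_; _<?_; >-nonZero)
open import Data.Nat.ListAction using (sum)
open import Data.Nat.Properties hiding (_≟_)
open import Data.Nat.Tactic.RingSolver using (solve-∀)
open import Data.Product using (Σ; ∃-syntax; _×_; _,_; proj₁; proj₂; map₂)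
open import Data.Product.Properties using (,-injective)
open import Data.Sum using (_⊎_; inj₁; inj₂)
import Data.Unit as Unit
open import Data.Vec as Vec using (Vec; []; _∷_; lookup; tabulate; toList)
open import Data.Vec.Properties using ([]=⇒lookup; lookup⇒[]=; lookup∘tabulate; tabulate-cong; length-toList)
open import Function using (_∘_; case_of_)
open import Function.Bundles using (_⇔_; mk⇔)
open import Relation.Binary using (DecidableEquality)
open import Relation.Binary.PropositionalEquality
open import Relation.Nullary using (does; yes; no; ¬_; contradiction)
open import Relation.Nullary.Decidable using (True; map′; _×-dec_)
open import Defs

-- The obstacle is one of direction: truth values propagate from the end of a word to its front,
-- while a machine reads from the front. The argument of the stored function stands for the
-- valuation of the part not yet read, so a new letter acts innermost. Keeping only the resulting
-- bit of `φ` makes a state a mere bit table over the valuations, and at most `2 ^ l` valuations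
-- give at most `2 ^ 2 ^ l` tables. All tables are enumerated, reachable or not: a product state is
-- then a pair coded by index arithmetic, and the program needs no graph search. On the empty trace
-- even `tt` counts as false. This makes the next operator strong at the last letter and keeps the
-- empty prefix from being accepted. Lookups compare encoded trees, exactly as the program does, so
-- that the program can be verified along the same case distinctions.

-- Finite witnesses of co-safety formulas

finite-mono : ∀ {k} (φ : CoSafety k) {σ i j j′} → j ≤ j′ → σ [ i ⋯ j ]⊢ φ → σ [ i ⋯ j′ ]⊢ φ
finite-mono tt        j≤ h       = h
finite-mono (atom e)  j≤ h       = h
finite-mono (¬atom e) j≤ h       = h
finite-mono (φ ∧ ψ)   j≤ (h , g) = finite-mono φ j≤ h , finite-mono ψ j≤ g
finite-mono (φ ∨ ψ)   j≤ (inj₁ h) = inj₁ (finite-mono φ j≤ h)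
finite-mono (φ ∨ ψ)   j≤ (inj₂ h) = inj₂ (finite-mono ψ j≤ h)
finite-mono (X φ)     j≤ (i< , h) = <-≤-trans i< j≤ , finite-mono φ j≤ h
finite-mono (φ U ψ)   j≤ (l , i≤l , l≤j , h , g) =
  l , i≤l , ≤-trans l≤j j≤ , finite-mono ψ j≤ h , λ m i≤m m<l → finite-mono φ j≤ (g m i≤m m<l)

-- Needed for until, where the left argument holds at several positions, each with its own end of
-- trace: monotonicity allows passing to the maximum.
uniform-bound : ∀ {P : ℕ → ℕ → Set} → (∀ {m j j′} → j ≤ j′ → P m j → P m j′) →
                ∀ l → (∀ m → m < l → ∃[ j ] P m j) → ∃[ j ] (∀ m → m < l → P m j)
uniform-bound mono zero    h = 0 , λ _ ()
uniform-bound mono (suc l) h =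
  let j , g  = uniform-bound mono l λ m m<l → h m (m<n⇒m<1+n m<l)
      j′ , p = h l ≤-refl
  in j ⊔ j′ , λ m m<1+l → case m≤n⇒m<n∨m≡n (s≤s⁻¹ m<1+l) of λ where
       (inj₁ m<l)  → mono (m≤m⊔n j j′) (g m m<l)
       (inj₂ refl) → mono (m≤n⊔m j j′) p

infinite⇒finite : ∀ {k} (φ : CoSafety k) {σ i} → σ , i ⊢ φ → ∃[ j ] σ [ i ⋯ j ]⊢ φ
-- The end 0 may lie before `i`: these clauses of the finite semantics look only at position `i` and
-- never at the end.
infinite⇒finite tt        h = 0 , h
infinite⇒finite (atom e)  h = 0 , h
infinite⇒finite (¬atom e) h = 0 , h
infinite⇒finite (φ ∧ ψ) (h , g) =
  let j , h′ = infinite⇒finite φ h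
      l , g′ = infinite⇒finite ψ g
  in j ⊔ l , finite-mono φ (m≤m⊔n j l) h′ , finite-mono ψ (m≤n⊔m j l) g′
infinite⇒finite (φ ∨ ψ) (inj₁ h) = map₂ inj₁ (infinite⇒finite φ h)
infinite⇒finite (φ ∨ ψ) (inj₂ h) = map₂ inj₂ (infinite⇒finite ψ h)
infinite⇒finite (X φ) {i = i} h =
  let j , h′ = infinite⇒finite φ h
  in suc i ⊔ j , m≤m⊔n (suc i) j , finite-mono φ (m≤n⊔m (suc i) j) h′
infinite⇒finite (φ U ψ) {σ} {i} (l , i≤l , h , g) =
  let j , h′ = infinite⇒finite ψ h
      b , g′ = uniform-bound {λ m n → i ≤ m → σ [ m ⋯ n ]⊢ φ}
                 (λ j≤ p i≤m → finite-mono φ j≤ (p i≤m)) l prefix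
      n      = l ⊔ (j ⊔ b)
  in n , l , i≤l , m≤m⊔n l _ , finite-mono ψ (≤-trans (m≤m⊔n j b) (m≤n⊔m l _)) h′ ,
     λ m i≤m m<l → finite-mono φ (≤-trans (m≤n⊔m j b) (m≤n⊔m l _)) (g′ m m<l i≤m)
  where
  prefix : ∀ m → m < l → ∃[ n ] (i ≤ m → σ [ m ⋯ n ]⊢ φ)
  prefix m m<l with i ≤? m
  ... | yes i≤m = map₂ (λ p _ → p) (infinite⇒finite φ (g m i≤m m<l))
  ... | no  i≰m = 0 , λ i≤m → contradiction i≤m i≰m

-- Valuations of the subformulas

mutual

  Val : ∀ {k} → CoSafety k → Set
  Val φ = Bool × Rest φ

  Rest : ∀ {k} → CoSafety k → Set
  Rest tt        = Unit.⊤
  Rest ff        = Unit.⊤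
  Rest (atom e)  = Unit.⊤
  Rest (¬atom e) = Unit.⊤
  Rest (φ ∧ ψ)   = Val φ × Val ψ
  Rest (φ ∨ ψ)   = Val φ × Val ψ
  Rest (X φ)     = Val φ
  Rest (φ U ψ)   = Val φ × Val ψ

-- These are the unfolding laws, the old bits describing the remainder of the trace. Next copies the
-- old bit of its argument; until is `ψ ∨ (φ ∧ X (φ U ψ))`, with the old bit `b` in the place of
-- `X (φ U ψ)`.
step : ∀ {k} (φ : CoSafety k) → Letter k → Val φ → Val φ
step tt        a v           = true , _
step ff        a v           = false , _
step (atom e)  a v           = lookup a e , _
step (¬atom e) a v           = not (lookup a e) , _
step (φ ∧ ψ)   a (_ , v , w) = proj₁ (step φ a v) Bool.∧ proj₁ (step ψ a w) , step φ a v , step ψ a w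
step (φ ∨ ψ)   a (_ , v , w) = proj₁ (step φ a v) Bool.∨ proj₁ (step ψ a w) , step φ a v , step ψ a w
step (X φ)     a (_ , v)     = proj₁ v , step φ a v
step (φ U ψ)   a (b , v , w) =
  proj₁ (step ψ a w) Bool.∨ (proj₁ (step φ a v) Bool.∧ b) , step φ a v , step ψ a w

mutual

  -- The valuation of the empty remainder. It is false even at `tt`, since `X tt` must fail at the
  -- last letter.
  bottom : ∀ {k} (φ : CoSafety k) → Val φ
  bottom φ = false , bottomRest φ

  bottomRest : ∀ {k} (φ : CoSafety k) → Rest φ
  bottomRest tt        = _
  bottomRest ff        = _
  bottomRest (atom e)  = _
  bottomRest (¬atom e) = _
  bottomRest (φ ∧ ψ)   = bottom φ , bottom ψ
  bottomRest (φ ∨ ψ)   = bottom φ , bottom ψ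
  bottomRest (X φ)     = bottom φ
  bottomRest (φ U ψ)   = bottom φ , bottom ψ

steps : ∀ {k} (φ : CoSafety k) → Trace k → (i n : ℕ) → Val φ → Val φ
steps φ σ i zero    v = v
steps φ σ i (suc n) v = step φ (σ i) (steps φ σ (suc i) n v)

-- `steps` recurses by prepending letters, whereas a run appends them; this passage from one to the
-- other makes an online monitor possible.
steps-snoc : ∀ {k} (φ : CoSafety k) σ i n v →
             steps φ σ i (suc n) v ≡ steps φ σ i n (step φ (σ (i + n)) v)
steps-snoc φ σ i zero    v = cong (λ j → step φ (σ j) v) (sym (+-identityʳ i))
steps-snoc φ σ i (suc n) v = cong (step φ (σ i)) (trans (steps-snoc φ σ (suc i) n v)
  (cong (λ j → steps φ σ (suc i) n (step φ (σ j) v)) (sym (+-suc i n))))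

-- The truth value of φ on the n letters from position i on.
value : ∀ {k} (φ : CoSafety k) → Trace k → (i n : ℕ) → Bool
value φ σ i n = proj₁ (steps φ σ i n (bottom φ))

-- The valuation of a subformula evolves independently of the bits above it, so inside a compound
-- formula it is the one the subformula has on its own.
steps-∧ : ∀ {k} (φ ψ : CoSafety k) σ i n → proj₂ (steps (φ ∧ ψ) σ i n (bottom (φ ∧ ψ)))
          ≡ (steps φ σ i n (bottom φ) , steps ψ σ i n (bottom ψ))
steps-∧ φ ψ σ i zero    = refl
steps-∧ φ ψ σ i (suc n) rewrite steps-∧ φ ψ σ (suc i) n = refl

steps-∨ : ∀ {k} (φ ψ : CoSafety k) σ i n → proj₂ (steps (φ ∨ ψ) σ i n (bottom (φ ∨ ψ)))
          ≡ (steps φ σ i n (bottom φ) , steps ψ σ i n (bottom ψ))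
steps-∨ φ ψ σ i zero    = refl
steps-∨ φ ψ σ i (suc n) rewrite steps-∨ φ ψ σ (suc i) n = refl

steps-X : ∀ {k} (φ : CoSafety k) σ i n → proj₂ (steps (X φ) σ i n (bottom (X φ)))
          ≡ steps φ σ i n (bottom φ)
steps-X φ σ i zero    = refl
steps-X φ σ i (suc n) rewrite steps-X φ σ (suc i) n = refl

steps-U : ∀ {k} (φ ψ : CoSafety k) σ i n → proj₂ (steps (φ U ψ) σ i n (bottom (φ U ψ)))
          ≡ (steps φ σ i n (bottom φ) , steps ψ σ i n (bottom ψ))
steps-U φ ψ σ i zero    = refl
steps-U φ ψ σ i (suc n) rewrite steps-U φ ψ σ (suc i) n = refl

value-∧ : ∀ {k} (φ ψ : CoSafety k) σ i n →
          value (φ ∧ ψ) σ i (suc n) ≡ value φ σ i (suc n) Bool.∧ value ψ σ i (suc n)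
value-∧ φ ψ σ i n rewrite steps-∧ φ ψ σ (suc i) n = refl

value-∨ : ∀ {k} (φ ψ : CoSafety k) σ i n →
          value (φ ∨ ψ) σ i (suc n) ≡ value φ σ i (suc n) Bool.∨ value ψ σ i (suc n)
value-∨ φ ψ σ i n rewrite steps-∨ φ ψ σ (suc i) n = refl

-- For `n = 0` the right-hand side reads `bottom`, which gives the strong next.
value-X : ∀ {k} (φ : CoSafety k) σ i n → value (X φ) σ i (suc n) ≡ value φ σ (suc i) n
value-X φ σ i n rewrite steps-X φ σ (suc i) n = refl

value-U : ∀ {k} (φ ψ : CoSafety k) σ i n → value (φ U ψ) σ i (suc n) ≡
          value ψ σ i (suc n) Bool.∨ (value φ σ i (suc n) Bool.∧ value (φ U ψ) σ (suc i) n)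
value-U φ ψ σ i n rewrite steps-U φ ψ σ (suc i) n = refl

-- Agreement of the computed value with finite-trace satisfaction

∧-true⁻ : ∀ {x y} → x Bool.∧ y ≡ true → x ≡ true × y ≡ true
∧-true⁻ {true} eq = refl , eq

∧-true⁺ : ∀ {x y} → x ≡ true → y ≡ true → x Bool.∧ y ≡ true
∧-true⁺ refl eq = eq

∨-true⁻ : ∀ {x y} → x Bool.∨ y ≡ true → x ≡ true ⊎ y ≡ true
∨-true⁻ {true}  eq = inj₁ refl
∨-true⁻ {false} eq = inj₂ eq

∨-true⁺ : ∀ {x y} → x ≡ true ⊎ y ≡ true → x Bool.∨ y ≡ true
∨-true⁺ (inj₁ refl)         = refl
∨-true⁺ {true}  (inj₂ eq)   = refl
∨-true⁺ {false} (inj₂ eq)   = eq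

mutual

  value-sound : ∀ {k} (φ : CoSafety k) σ i n → value φ σ i (suc n) ≡ true → σ [ i ⋯ i + n ]⊢ φ
  value-sound tt        σ i n h = _
  value-sound (atom e)  σ i n h = lookup⇒[]= e (σ i) h
  value-sound (¬atom e) σ i n h e∈ with lookup (σ i) e | []=⇒lookup e∈
  value-sound (¬atom e) σ i n () e∈ | .true | refl
  value-sound (φ ∧ ψ)   σ i n h =
    let p , q = ∧-true⁻ (trans (sym (value-∧ φ ψ σ i n)) h)
    in value-sound φ σ i n p , value-sound ψ σ i n q
  value-sound (φ ∨ ψ)   σ i n h with ∨-true⁻ (trans (sym (value-∨ φ ψ σ i n)) h)
  ... | inj₁ p = inj₁ (value-sound φ σ i n p)
  ... | inj₂ q = inj₂ (value-sound ψ σ i n q)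
  value-sound (X φ)     σ i n h with n | trans (sym (value-X φ σ i n)) h
  ... | suc n | p rewrite +-suc i n = s≤s (m≤m+n i n) , value-sound φ σ (suc i) n p
  value-sound (φ U ψ)   σ i n h = until-sound φ ψ σ i n h

  -- Unfolding an until keeps the formula and moves on by one letter, so this recursion is on `n`,
  -- nested inside the recursion on formulas.
  until-sound : ∀ {k} (φ ψ : CoSafety k) σ i n →
                value (φ U ψ) σ i (suc n) ≡ true → σ [ i ⋯ i + n ]⊢ φ U ψ
  until-sound φ ψ σ i n h with ∨-true⁻ (trans (sym (value-U φ ψ σ i n)) h)
  ... | inj₁ p = i , ≤-refl , m≤m+n i n , value-sound ψ σ i n p ,
                 λ m i≤m m<i → contradiction i≤m (<⇒≱ m<i)
  until-sound φ ψ σ i n h | inj₂ q with ∧-true⁻ {value φ σ i (suc n)} q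
  -- No letters remain, so the until on the remainder has the bit of `bottom`, which is false.
  until-sound φ ψ σ i zero    h | inj₂ q | p , ()
  until-sound φ ψ σ i (suc n) h | inj₂ q | p , r
    with until-sound φ ψ σ (suc i) n r | value-sound φ σ i (suc n) p
  ... | l , i<l , l≤ , g , f | p′ rewrite +-suc i n =
    l , <⇒≤ i<l , l≤ , g , λ m i≤m m<l → case m≤n⇒m<n∨m≡n i≤m of λ where
      (inj₁ i<m)  → f m i<m m<l
      (inj₂ refl) → p′

mutual

  value-complete : ∀ {k} (φ : CoSafety k) σ i n → σ [ i ⋯ i + n ]⊢ φ → value φ σ i (suc n) ≡ true
  value-complete tt        σ i n h = refl
  value-complete (atom e)  σ i n h = []=⇒lookup h
  value-complete (¬atom e) σ i n h with lookup (σ i) e in eq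
  ... | true  = contradiction (lookup⇒[]= e (σ i) eq) h
  ... | false = refl
  value-complete (φ ∧ ψ)   σ i n (h , g) = trans (value-∧ φ ψ σ i n)
    (∧-true⁺ (value-complete φ σ i n h) (value-complete ψ σ i n g))
  value-complete (φ ∨ ψ)   σ i n (inj₁ h) = trans (value-∨ φ ψ σ i n)
    (∨-true⁺ (inj₁ (value-complete φ σ i n h)))
  value-complete (φ ∨ ψ)   σ i n (inj₂ h) = trans (value-∨ φ ψ σ i n)
    (∨-true⁺ (inj₂ (value-complete ψ σ i n h)))
  value-complete (X φ)     σ i zero    (i< , h) =
    contradiction i< (<-irrefl (sym (+-identityʳ i)))
  value-complete (X φ)     σ i (suc n) (i< , h) rewrite +-suc i n =
    trans (value-X φ σ i (suc n)) (value-complete φ σ (suc i) n h)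
  value-complete (φ U ψ)   σ i n h = until-complete φ ψ σ i n h

  until-complete : ∀ {k} (φ ψ : CoSafety k) σ i n →
                   σ [ i ⋯ i + n ]⊢ φ U ψ → value (φ U ψ) σ i (suc n) ≡ true
  until-complete φ ψ σ i n (l , i≤l , l≤ , g , f) with m≤n⇒m<n∨m≡n i≤l
  ... | inj₂ refl = trans (value-U φ ψ σ i n) (∨-true⁺ (inj₁ (value-complete ψ σ i n g)))
  until-complete φ ψ σ i zero (l , i≤l , l≤ , g , f) | inj₁ i<l =
    contradiction (<-≤-trans i<l l≤) (<-irrefl (sym (+-identityʳ i)))
  until-complete φ ψ σ i (suc n) (l , i≤l , l≤ , g , f) | inj₁ i<l =
    trans (value-U φ ψ σ i (suc n)) (∨-true⁺ (inj₂ (∧-true⁺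
      (value-complete φ σ i (suc n) (f i ≤-refl i<l))
      (until-complete φ ψ σ (suc i) n
        (subst (λ j → σ [ suc i ⋯ j ]⊢ φ U ψ) (+-suc i n)
          (l , i<l , l≤ , g , λ m i<m → f m (<⇒≤ i<m)))))))

-- Enumerations and encodings

encList : ∀ {A : Set} → (A → Tree) → List A → Tree
encList enc []       = nil
encList enc (x ∷ xs) = enc x ∙ encList enc xs

encBits : List Bool → Tree
encBits = encList encBool

mutual

  encVal : ∀ {k} (φ : CoSafety k) → Val φ → Tree
  encVal φ (b , r) = encBool b ∙ encRest φ r

  encRest : ∀ {k} (φ : CoSafety k) → Rest φ → Tree
  encRest tt        _       = nil
  encRest ff        _       = nil
  encRest (atom e)  _       = nil
  encRest (¬atom e) _       = nil
  encRest (φ ∧ ψ)   (v , w) = encVal φ v ∙ encVal ψ w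
  encRest (φ ∨ ψ)   (v , w) = encVal φ v ∙ encVal ψ w
  encRest (X φ)     v       = encVal φ v
  encRest (φ U ψ)   (v , w) = encVal φ v ∙ encVal ψ w

∙-injective : ∀ {x x′ y y′} → x ∙ y ≡ x′ ∙ y′ → x ≡ x′ × y ≡ y′
∙-injective refl = refl , refl

encBool-injective : ∀ {b c} → encBool b ≡ encBool c → b ≡ c
encBool-injective {true}  {true}  _ = refl
encBool-injective {false} {false} _ = refl

encBits-injective : ∀ {f g} → encBits f ≡ encBits g → f ≡ g
encBits-injective {[]}    {[]}    _ = refl
encBits-injective {_ ∷ _} {_ ∷ _} e =
  let p , q = ∙-injective e in cong₂ _∷_ (encBool-injective p) (encBits-injective q)

mutual

  encVal-injective : ∀ {k} (φ : CoSafety k) {v w} → encVal φ v ≡ encVal φ w → v ≡ w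
  encVal-injective φ e =
    let p , q = ∙-injective e in cong₂ _,_ (encBool-injective p) (encRest-injective φ q)

  encPair-injective : ∀ {k} (φ ψ : CoSafety k) {v v′ w w′} →
                      encVal φ v ∙ encVal ψ w ≡ encVal φ v′ ∙ encVal ψ w′ → (v , w) ≡ (v′ , w′)
  encPair-injective φ ψ e =
    let p , q = ∙-injective e in cong₂ _,_ (encVal-injective φ p) (encVal-injective ψ q)

  encRest-injective : ∀ {k} (φ : CoSafety k) {r s} → encRest φ r ≡ encRest φ s → r ≡ s
  encRest-injective tt        e = refl
  encRest-injective ff        e = refl
  encRest-injective (atom _)  e = refl
  encRest-injective (¬atom _) e = refl
  encRest-injective (φ ∧ ψ)   e = encPair-injective φ ψ e
  encRest-injective (φ ∨ ψ)   e = encPair-injective φ ψ e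
  encRest-injective (X φ)     e = encVal-injective φ e
  encRest-injective (φ U ψ)   e = encPair-injective φ ψ e

bools : List Bool
bools = false ∷ true ∷ []

∈-bools : ∀ b → b ∈ bools
∈-bools false = here refl
∈-bools true  = there (here refl)

mutual

  vals : ∀ {k} (φ : CoSafety k) → List (Val φ)
  vals φ = cartesianProduct bools (rests φ)

  rests : ∀ {k} (φ : CoSafety k) → List (Rest φ)
  rests tt        = _ ∷ []
  rests ff        = _ ∷ []
  rests (atom e)  = _ ∷ []
  rests (¬atom e) = _ ∷ []
  rests (φ ∧ ψ)   = cartesianProduct (vals φ) (vals ψ)
  rests (φ ∨ ψ)   = cartesianProduct (vals φ) (vals ψ)
  rests (X φ)     = vals φ
  rests (φ U ψ)   = cartesianProduct (vals φ) (vals ψ)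

mutual

  ∈-vals : ∀ {k} (φ : CoSafety k) v → v ∈ vals φ
  ∈-vals φ (b , r) = ∈-cartesianProduct⁺ (∈-bools b) (∈-rests φ r)

  ∈-rests : ∀ {k} (φ : CoSafety k) r → r ∈ rests φ
  ∈-rests tt        r       = here refl
  ∈-rests ff        r       = here refl
  ∈-rests (atom e)  r       = here refl
  ∈-rests (¬atom e) r       = here refl
  ∈-rests (φ ∧ ψ)   (v , w) = ∈-cartesianProduct⁺ (∈-vals φ v) (∈-vals ψ w)
  ∈-rests (φ ∨ ψ)   (v , w) = ∈-cartesianProduct⁺ (∈-vals φ v) (∈-vals ψ w)
  ∈-rests (X φ)     v       = ∈-vals φ v
  ∈-rests (φ U ψ)   (v , w) = ∈-cartesianProduct⁺ (∈-vals φ v) (∈-vals ψ w)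

cartesianProduct-∷ : ∀ {A B : Set} {x : A} {y : B} {xs ys} →
  ∃[ xs′ ] xs ≡ x ∷ xs′ → ∃[ ys′ ] ys ≡ y ∷ ys′ →
  ∃[ zs ] cartesianProduct xs ys ≡ (x , y) ∷ zs
cartesianProduct-∷ (_ , refl) (_ , refl) = _ , refl

mutual

  -- As `bools` begins with `false`, the all-false valuation heads the enumeration, and acceptance
  -- can be read off the first bit of a state.
  vals-∷ : ∀ {k} (φ : CoSafety k) → ∃[ vs ] vals φ ≡ bottom φ ∷ vs
  vals-∷ φ = cartesianProduct-∷ {xs = bools} (_ , refl) (rests-∷ φ)

  rests-∷ : ∀ {k} (φ : CoSafety k) → ∃[ rs ] rests φ ≡ bottomRest φ ∷ rs
  rests-∷ tt        = _ , refl
  rests-∷ ff        = _ , refl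
  rests-∷ (atom e)  = _ , refl
  rests-∷ (¬atom e) = _ , refl
  rests-∷ (φ ∧ ψ)   = cartesianProduct-∷ (vals-∷ φ) (vals-∷ ψ)
  rests-∷ (φ ∨ ψ)   = cartesianProduct-∷ (vals-∷ φ) (vals-∷ ψ)
  rests-∷ (X φ)     = vals-∷ φ
  rests-∷ (φ U ψ)   = cartesianProduct-∷ (vals-∷ φ) (vals-∷ ψ)

bits : ∀ {A : Set} → List A → List (List Bool)
bits []       = [] ∷ []
bits (_ ∷ xs) = cartesianProductWith _∷_ bools (bits xs)

map∈bits : ∀ {A : Set} (g : A → Bool) xs → map g xs ∈ bits xs
map∈bits g []       = here refl
map∈bits g (x ∷ xs) = ∈-cartesianProductWith⁺ _∷_ (∈-bools (g x)) (map∈bits g xs)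

infix 4 _≟_

_≟_ : DecidableEquality Tree
nil     ≟ nil       = yes refl
nil     ≟ (_ ∙ _)   = no λ ()
(_ ∙ _) ≟ nil       = no λ ()
(x ∙ y) ≟ (x′ ∙ y′) = map′ (λ { (refl , refl) → refl }) ∙-injective ((x ≟ x′) ×-dec (y ≟ y′))

-- Evaluates a function given by its table. Keys are compared through their encodings, as `EQ` does
-- in the program.
assoc : ∀ {A : Set} → (A → Tree) → A → List A → List Bool → Bool
assoc enc x (y ∷ ys) (b ∷ bs) = Bool.if does (enc x ≟ enc y) then b else assoc enc x ys bs
assoc enc x _        _        = false

assoc-map : ∀ {A : Set} {enc : A → Tree} → (∀ {x y} → enc x ≡ enc y → x ≡ y) →
            (g : A → Bool) → ∀ {x xs} → x ∈ xs → assoc enc x xs (map g xs) ≡ g x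
assoc-map {enc = enc} inj g {x} {y ∷ ys} x∈ with enc x ≟ enc y
... | yes e = cong g (sym (inj e))
... | no ¬e = assoc-map inj g (tail (¬e ∘ cong enc) x∈)

-- The membership proof only rules out the empty list; the index is found by tree comparison, hence
-- computable by `INDEX` from the encodings.
position : ∀ {f fs} → f ∈ fs → Fin (length fs)
position {f} {g ∷ fs} f∈ with encBits f ≟ encBits g
... | yes _ = zero
... | no ¬e = suc (position (tail (¬e ∘ cong encBits) f∈))

lookup-position : ∀ {f fs} (f∈ : f ∈ fs) → List.lookup fs (position f∈) ≡ f
lookup-position {f} {g ∷ fs} f∈ with encBits f ≟ encBits g
... | yes e = encBits-injective (sym e)
... | no ¬e = lookup-position (tail (¬e ∘ cong encBits) f∈)

-- A state of the monitor is a function Val φ → Bool, given by its list of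
-- values along vals φ.

Monitor : ∀ {k} → CoSafety k → List (List Bool)
Monitor φ = bits (vals φ)

initial : ∀ {k} → CoSafety k → List Bool
initial φ = map proj₁ (vals φ)

next : ∀ {k} (φ : CoSafety k) → Letter k → List Bool → List Bool
next φ a f = map (λ v → assoc (encVal φ) (step φ a v) (vals φ) f) (vals φ)

initial∈Monitor : ∀ {k} (φ : CoSafety k) → initial φ ∈ Monitor φ
initial∈Monitor φ = map∈bits proj₁ (vals φ)

next∈Monitor : ∀ {k} (φ : CoSafety k) a f → next φ a f ∈ Monitor φ
next∈Monitor φ a f = map∈bits (λ v → assoc (encVal φ) (step φ a v) (vals φ) f) (vals φ)

accepting : List Bool → Bool
accepting []      = false
accepting (b ∷ _) = b

after : ∀ {k} (φ : CoSafety k) → Trace k → ℕ → List Bool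
after φ σ n = map (λ v → proj₁ (steps φ σ 0 n v)) (vals φ)

-- The table lookup evaluates the stored function at `step φ (σ n) v`, which by `steps-snoc` amounts
-- to one more letter.
after-suc : ∀ {k} (φ : CoSafety k) σ n → next φ (σ n) (after φ σ n) ≡ after φ σ (suc n)
after-suc φ σ n = map-cong (λ v → trans
  (assoc-map (encVal-injective φ) _ (∈-vals φ (step φ (σ n) v)))
  (cong proj₁ (sym (steps-snoc φ σ 0 n v)))) (vals φ)

accepting-after : ∀ {k} (φ : CoSafety k) σ n → accepting (after φ σ n) ≡ value φ σ 0 n
accepting-after φ σ n with vals φ | vals-∷ φ
... | _ | _ , refl = refl

-- The product of a machine with the monitor

module Product {k} {Pin Pout : Subset k} (φ : CoSafety k) (C : Mealy Pin Pout) where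
  open Mealy C renaming (trans to δ)

  monitorOf : Fin (length (Monitor φ) * states) → List Bool
  monitorOf q = List.lookup (Monitor φ) (proj₁ (remQuot states q))

  machineOf : Fin (length (Monitor φ) * states) → Fin states
  machineOf q = proj₂ (remQuot {length (Monitor φ)} states q)

  initialIndex : Fin (length (Monitor φ))
  initialIndex = position (initial∈Monitor φ)

  nextIndex : Letter k → List Bool → Fin (length (Monitor φ))
  nextIndex a f = position (next∈Monitor φ a f)

  -- Transforms one entry of the transition table of `C`, which lets `TABLE` work leaf by leaf. The
  -- monitor reads outputs too, hence the union with `O`.
  target : List Bool → Letter k → Sub Pout × Fin states →
           Sub Pout × Fin (length (Monitor φ) * states)
  target f a (O , s) = O , combine (nextIndex (a ∪ embed Pout O) f) s

  product : Mealy Pin Pout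
  product = record
    { states = length (Monitor φ) * states
    ; start  = combine initialIndex start
    ; trans  = λ q I → target (monitorOf q) (embed Pin I) (δ (machineOf q) I)
    ; final  = tabulate (accepting ∘ monitorOf)
    }

  monitorOf-combine : ∀ {f} (f∈ : f ∈ Monitor φ) s → monitorOf (combine (position f∈) s) ≡ f
  monitorOf-combine f∈ s = trans
    (cong (List.lookup (Monitor φ) ∘ proj₁) (remQuot-combine (position f∈) s)) (lookup-position f∈)

  machineOf-combine : ∀ (i : Fin (length (Monitor φ))) s → machineOf (combine i s) ≡ s
  machineOf-combine i s = cong proj₂ (remQuot-combine i s)

  module _ (r : Run product) where
    private module R = Run r

    machineRun : Run C
    machineRun = record
      { state   = machineOf ∘ R.state
      ; input   = R.input
      ; output  = R.output
      ; initial = trans (cong machineOf R.initial) (machineOf-combine initialIndex start)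
      ; step    = λ i → let p , q = ,-injective (R.step i) in
          cong₂ _,_ p (trans (sym (machineOf-combine
            (nextIndex (embed Pin (R.input i) ∪ embed Pout _) (monitorOf (R.state i))) _)) (cong machineOf q))
      }

    monitor-after : ∀ n → monitorOf (R.state n) ≡ after φ R.word n
    monitor-after zero    =
      trans (cong monitorOf R.initial) (monitorOf-combine (initial∈Monitor φ) start)
    monitor-after (suc n) = begin
      monitorOf (R.state (suc n))
        ≡⟨ cong monitorOf (sym (proj₂ (,-injective (R.step n)))) ⟩
      monitorOf (proj₂ (Mealy.trans product (R.state n) (R.input n)))
        ≡⟨ monitorOf-combine (next∈Monitor φ _ (monitorOf (R.state n))) _ ⟩
      next φ (embed Pin (R.input n) ∪ embed Pout (proj₁ (δ (machineOf (R.state n)) (R.input n))))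
           (monitorOf (R.state n))
        ≡⟨ cong₂ (λ O → next φ (embed Pin (R.input n) ∪ embed Pout O))
             (proj₁ (,-injective (R.step n))) (monitor-after n) ⟩
      next φ (R.word n) (after φ R.word n)
        ≡⟨ after-suc φ R.word n ⟩
      after φ R.word (suc n) ∎
      where open ≡-Reasoning

    accepts-value : ∀ n → lookup (Mealy.final product) (R.state n) ≡ value φ R.word 0 n
    accepts-value n = begin
      lookup (Mealy.final product) (R.state n)  ≡⟨ lookup∘tabulate _ (R.state n) ⟩
      accepting (monitorOf (R.state n))         ≡⟨ cong accepting (monitor-after n) ⟩
      accepting (after φ R.word n)              ≡⟨ accepting-after φ R.word n ⟩
      value φ R.word 0 n                        ∎
      where open ≡-Reasoning

-- Tight realisation by the product

least-true : ∀ (b : ℕ → Bool) n → b n ≡ true → ∃[ m ] b m ≡ true × (∀ l → l < m → b l ≡ false)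
least-true b zero    h = 0 , h , λ _ ()
least-true b (suc n) h with b 0 in eq
... | true  = 0 , eq , λ _ ()
... | false =
  let m , p , q = least-true (b ∘ suc) n h
  in suc m , p , λ { zero _ → eq ; (suc l) (s≤s l<m) → q l l<m }

true≢false : ∀ {b} → b ≡ true → b ≡ false → ∀ {A : Set} → A
true≢false refl ()

product-tight : ∀ {k} {Pin Pout : Subset k} (γ : Assumption k) (φ : CoSafety k) (C : Mealy Pin Pout) →
                C Realises γ ⟶ φ → Product.product φ C TightlyRealises γ ⟶ φ
product-tight γ φ C real = realises , tight
  where
  open Product φ C
  realises : product Realises γ ⟶ φ
  -- The monitor only observes: inputs and outputs of the two runs coincide, so their words are
  -- equal by computation.
  realises r = real (machineRun r)

  tight : (r : Run product) → let open Run r in word , 0 ⊢γ γ →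
    ∃[ n ] Accepts (suc n) × word [ 0 ⋯ n ]⊩ φ × (∀ m → m ≤ n → ¬ Accepts m)
  tight r h =
    let j , p     = infinite⇒finite φ (realises r h)
        -- The search runs over the lengths `suc n` of nonempty prefixes; the empty prefix is dealt
        -- with below.
        n , q , l = least-true (λ n → value φ word 0 (suc n)) j (value-complete φ word 0 j p)
    in n , lookup⇒[]= _ _ (trans (accepts-value r (suc n)) q)
     , (value-sound φ word 0 n q ,
        λ m _ m<n s → true≢false (value-complete φ word 0 m s) (l m m<n))
     -- At length 0 the value is the bit of `bottom`, false by computation.
     , λ { zero m≤n a    → true≢false ([]=⇒lookup a) (accepts-value r 0)
         ; (suc m) m<n a → true≢false ([]=⇒lookup a) (trans (accepts-value r (suc m)) (l m m<n)) }
    where open Run r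

-- Counting calls

mutual

  exprSize : ∀ {f} {arity : Fin f → ℕ} {n} → Expr arity n → ℕ
  exprSize (var x)        = 1
  exprSize nil            = 1
  exprSize (cons e₁ e₂)   = suc (exprSize e₁ + exprSize e₂)
  exprSize (case e e₁ e₂) = suc (exprSize e + (exprSize e₁ + exprSize e₂))
  exprSize (call g es)    = suc (exprsSize es)

  exprsSize : ∀ {f} {arity : Fin f → ℕ} {n a} → Vec (Expr arity n) a → ℕ
  exprsSize []       = 0
  exprsSize (e ∷ es) = exprSize e + exprsSize es

lookup≤sum : ∀ {n} (xs : Vec ℕ n) i → lookup xs i ≤ Vec.sum xs
lookup≤sum (x ∷ xs) zero    = m≤m+n x _
lookup≤sum (x ∷ xs) (suc i) = ≤-trans (lookup≤sum xs i) (m≤n+m _ x)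

slack : ∀ {a b} s → a + s ≡ b → a ≤ b
slack s refl = m≤m+n _ s

module Calls {f : ℕ} {arity : Fin f → ℕ} (body : (g : Fin f) → Expr arity (arity g)) where

  infix 4 _⊢_⇓_#_ _⊢*_⇓_#_

  mutual

    -- ρ ⊢ e ⇓ v # c : in environment ρ, e evaluates to v with at most c calls.
    data _⊢_⇓_#_ {n : ℕ} (ρ : Vec Tree n) : Expr arity n → Tree → ℕ → Set where
      var⇓   : ∀ {x} → ρ ⊢ var x ⇓ lookup ρ x # 0
      nil⇓   : ρ ⊢ nil ⇓ nil # 0
      cons⇓  : ∀ {e₁ e₂ v₁ v₂ c₁ c₂} → ρ ⊢ e₁ ⇓ v₁ # c₁ → ρ ⊢ e₂ ⇓ v₂ # c₂ →
               ρ ⊢ cons e₁ e₂ ⇓ v₁ ∙ v₂ # c₁ + c₂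
      case⇓₁ : ∀ {e e₁ e₂ v c c₁} → ρ ⊢ e ⇓ nil # c → ρ ⊢ e₁ ⇓ v # c₁ →
               ρ ⊢ case e e₁ e₂ ⇓ v # c + c₁
      case⇓₂ : ∀ {e e₁ e₂ x y v c c₂} → ρ ⊢ e ⇓ x ∙ y # c → (x ∷ y ∷ ρ) ⊢ e₂ ⇓ v # c₂ →
               ρ ⊢ case e e₁ e₂ ⇓ v # c + c₂
      call⇓  : ∀ {g es vs v c c′} → ρ ⊢* es ⇓ vs # c → vs ⊢ body g ⇓ v # c′ →
               ρ ⊢ call g es ⇓ v # suc (c + c′)
      -- Counts may be rounded up anywhere inside a derivation, so that one closed bound per
      -- function covers all its branches.
      weaken : ∀ {e v c c′} → c ≤ c′ → ρ ⊢ e ⇓ v # c → ρ ⊢ e ⇓ v # c′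

    infixr 5 _∷⇓_

    data _⊢*_⇓_#_ {n : ℕ} (ρ : Vec Tree n) : ∀ {a} → Vec (Expr arity n) a → Vec Tree a → ℕ → Set where
      []⇓  : ρ ⊢* [] ⇓ [] # 0
      _∷⇓_ : ∀ {a e v c c′} {es : Vec (Expr arity n) a} {vs : Vec Tree a} →
             ρ ⊢ e ⇓ v # c → ρ ⊢* es ⇓ vs # c′ → ρ ⊢* (e ∷ es) ⇓ (v ∷ vs) # c + c′

  convert : ∀ {n} {ρ : Vec Tree n} {e v v′ c} → v ≡ v′ → ρ ⊢ e ⇓ v # c → ρ ⊢ e ⇓ v′ # c
  convert refl d = d

  bodySize : ℕ
  bodySize = Vec.sum (tabulate (exprSize ∘ body))

  body≤bodySize : ∀ g → exprSize (body g) ≤ bodySize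
  body≤bodySize g = subst (_≤ bodySize) (lookup∘tabulate (exprSize ∘ body) g)
    (lookup≤sum (tabulate (exprSize ∘ body)) g)

  open Evaluation body

  private
    K = bodySize

    add : ∀ {t t′ s s′} c c′ → t ≤ s + K * c → t′ ≤ s′ + K * c′ →
          t + t′ ≤ s + s′ + K * (c + c′)
    add {s = s} {s′} c c′ p q = ≤-trans (+-mono-≤ p q) (≤-reflexive (eq s s′ K c c′))
      where
      eq : ∀ s s′ k c c′ → s + k * c + (s′ + k * c′) ≡ s + s′ + k * (c + c′)
      eq = solve-∀

    widen : ∀ {t s s′} c → s ≤ s′ → t ≤ s + K * c → t ≤ s′ + K * c
    widen c s≤ p = ≤-trans p (+-monoˡ-≤ (K * c) s≤)

  mutual

    -- Between two calls, evaluation only walks through one body.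
    time : ∀ {n} {ρ : Vec Tree n} {e v c} → ρ ⊢ e ⇓ v # c →
           ∃[ t ] t ≤ exprSize e + K * c × ρ ⊢ e ⇓ v ⟨ t ⟩
    time var⇓ = 1 , m≤m+n 1 _ , var⇓
    time nil⇓ = 1 , m≤m+n 1 _ , nil⇓
    time (cons⇓ {c₁ = c₁} {c₂} d₁ d₂) =
      let t₁ , p₁ , d₁′ = time d₁
          t₂ , p₂ , d₂′ = time d₂
      in _ , s≤s (add c₁ c₂ p₁ p₂) , cons⇓ d₁′ d₂′
    time (case⇓₁ {e₁ = e₁} {e₂} {c = c} {c₁} d d₁) =
      let t , p , d′    = time d
          t₁ , p₁ , d₁′ = time d₁
      in _ , s≤s (add c c₁ p (widen c₁ (m≤m+n (exprSize e₁) (exprSize e₂)) p₁)) , case⇓₁ d′ d₁′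
    time (case⇓₂ {e₁ = e₁} {e₂} {c = c} {c₂} d d₂) =
      let t , p , d′    = time d
          t₂ , p₂ , d₂′ = time d₂
      in _ , s≤s (add c c₂ p (widen c₂ (m≤n+m (exprSize e₂) (exprSize e₁)) p₂)) , case⇓₂ d′ d₂′
    time (call⇓ {g = g} {es} {c = c} {c′} ds d) =
      let t , p , ds′ = times ds
          t′ , q , d′ = time d
      in _ , s≤s (≤-trans (add c c′ p (widen c′ (body≤bodySize g) q))
                          (≤-reflexive (eq (exprsSize es) K c c′))) , call⇓ ds′ d′
      where
      eq : ∀ s k c c′ → s + k + k * (c + c′) ≡ s + k * suc (c + c′)
      eq = solve-∀
    time (weaken c≤ d) =
      let t , p , d′ = time d
      in t , ≤-trans p (+-monoʳ-≤ _ (*-monoʳ-≤ K c≤)) , d′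

    times : ∀ {n} {ρ : Vec Tree n} {a} {es : Vec (Expr arity n) a} {vs c} → ρ ⊢* es ⇓ vs # c →
            ∃[ t ] t ≤ exprsSize es + K * c × ρ ⊢* es ⇓ vs ⟨ t ⟩
    times []⇓ = 0 , z≤n , []⇓
    times (_∷⇓_ {c = c} {c′} d ds) =
      let t , p , d′   = time d
          t′ , q , ds′ = times ds
      in _ , add c c′ p q , d′ ∷⇓ ds′

-- The program

pattern NOT     = zero
pattern AND     = suc NOT
pattern OR      = suc AND
pattern EQ      = suc OR
pattern CONSAPP = suc EQ
pattern PROD    = suc CONSAPP
pattern VALS    = suc PROD
pattern BITS    = suc VALS
pattern ASSOC   = suc BITS
pattern PAD     = suc ASSOC
pattern INDEX   = suc PAD
pattern EMBED   = suc INDEX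
pattern UNION   = suc EMBED
pattern REV     = suc UNION
pattern NTH     = suc REV
pattern STEP    = suc NTH
pattern NEXT    = suc STEP
pattern HEADS   = suc NEXT
pattern TABLE   = suc HEADS
pattern ROWS    = suc TABLE
pattern TRANS   = suc ROWS
pattern COUNT   = suc TRANS
pattern FINAL   = suc COUNT

arities : Vec ℕ 23
arities = 1 ∷ 2 ∷ 2 ∷ 2 ∷ 3 ∷ 2 ∷ 1 ∷ 1 ∷ 3 ∷ 3 ∷ 4 ∷ 2 ∷ 2 ∷ 2 ∷ 2 ∷ 3 ∷ 5 ∷ 1 ∷ 9 ∷ 9 ∷ 8 ∷ 2 ∷ 2 ∷ []

arity : Fin 23 → ℕ
arity = lookup arities

v : ∀ m {n} {m<n : True (m <? n)} → Expr arity n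
v m {m<n = m<n} = var (#_ m {m<n = m<n})

TRUE BOOLS : ∀ {n} → Expr arity n
TRUE  = cons nil nil
BOOLS = cons nil (cons TRUE nil)

-- In the branch of tag t, the remaining variables are shifted by 2 t.
switch : ∀ {n} → Expr arity n → Expr arity n → Expr arity (2 + n) → Expr arity (4 + n) →
         Expr arity (6 + n) → Expr arity (8 + n) → Expr arity (10 + n) → Expr arity (12 + n) →
         Expr arity (14 + n) → Expr arity n
switch e e₀ e₁ e₂ e₃ e₄ e₅ e₆ e₇ =
  case e e₀ (case (v 1) e₁ (case (v 1) e₂ (case (v 1) e₃
    (case (v 1) e₄ (case (v 1) e₅ (case (v 1) e₆ e₇))))))

pairs : ∀ {n} → Fin n → Expr arity n
pairs x = case (var x) nil (call PROD (call VALS (v 0 ∷ []) ∷ call VALS (v 1 ∷ []) ∷ []))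

restsOf : Expr arity 1
restsOf = case (v 0) nil (switch (v 0) [nil] [nil] [nil] [nil] (pairs (# 9)) (pairs (# 11))
            (call VALS (v 13 ∷ [])) (pairs (# 15)))
  where
  [nil] : ∀ {n} → Expr arity n
  [nil] = cons nil nil

-- bit refers to the new values of the two subformulas as variables 2 and 0
-- and to the old value of the formula as variable 6.
binary : ∀ {n} (φ a w : Fin n) (bit : Expr arity (10 + n)) → Expr arity n
binary φ a w bit =
  case (var φ) nil
  (case (var (suc (suc w))) nil
  (case (v 1) nil
  (case (call STEP (v 4 ∷ var (6 ↑ʳ a) ∷ v 0 ∷ [])) nil
  (case (call STEP (v 7 ∷ var (8 ↑ʳ a) ∷ v 3 ∷ [])) nil
  (cons bit (cons (cons (v 2) (v 3)) (cons (v 0) (v 1))))))))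

-- The last six arguments of TABLE are Pout, φ, its valuations, the states of
-- the monitor, the number of states of the machine, and the current state of
-- the monitor; its first three are a final segment of Pin, the reversed letter
-- chosen on the segment before it, and a subtree of a row of the table.
body : (g : Fin 23) → Expr arity (arity g)
body NOT     = case (v 0) TRUE nil
body AND     = case (v 0) nil (v 3)
body OR      = case (v 0) (v 1) TRUE
body EQ      = case (v 0) (case (v 1) TRUE nil)
                 (case (v 3) nil (case (call EQ (v 2 ∷ v 0 ∷ [])) nil (call EQ (v 5 ∷ v 3 ∷ []))))
body CONSAPP = case (v 1) (v 2) (cons (cons (v 2) (v 0)) (call CONSAPP (v 2 ∷ v 1 ∷ v 4 ∷ [])))
body PROD    = case (v 0) nil (call CONSAPP (v 0 ∷ v 3 ∷ call PROD (v 1 ∷ v 3 ∷ []) ∷ []))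
body VALS    = call PROD (BOOLS ∷ restsOf ∷ [])
body BITS    = case (v 0) (cons nil nil) (call PROD (BOOLS ∷ call BITS (v 1 ∷ []) ∷ []))
body ASSOC   = case (v 1) nil (case (v 4) nil
                 (case (call EQ (v 4 ∷ v 2 ∷ [])) (call ASSOC (v 4 ∷ v 3 ∷ v 1 ∷ [])) (v 2)))
body PAD     = case (v 0) (v 2) (cons (v 3) (call PAD (v 1 ∷ v 3 ∷ v 4 ∷ [])))
body INDEX   = case (v 1) nil (case (call EQ (v 2 ∷ v 0 ∷ []))
                 (call PAD (v 4 ∷ nil ∷ call INDEX (v 2 ∷ v 1 ∷ v 4 ∷ v 5 ∷ []) ∷ [])) (v 7))
body EMBED   = case (v 0) nil (case (v 0) (cons nil (call EMBED (v 1 ∷ v 3 ∷ [])))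
                 (case (v 5) nil (cons (v 0) (call EMBED (v 5 ∷ v 1 ∷ [])))))
body UNION   = case (v 0) nil (case (v 3) nil
                 (cons (call OR (v 2 ∷ v 0 ∷ [])) (call UNION (v 3 ∷ v 1 ∷ []))))
body REV     = case (v 0) (v 1) (call REV (v 1 ∷ cons (v 0) (v 3) ∷ []))
body NTH     = case (v 1) nil (case (v 2) (v 0) (call NTH (v 1 ∷ v 3 ∷ [])))
body STEP    = case (v 0) nil (switch (v 0)
                 (cons TRUE nil)
                 (cons nil nil)
                 (cons (call NTH (v 5 ∷ v 7 ∷ [])) nil)
                 (cons (call NOT (call NTH (v 7 ∷ v 9 ∷ []) ∷ [])) nil)
                 (binary (# 9) (# 11) (# 12) (call AND (v 2 ∷ v 0 ∷ [])))
                 (binary (# 11) (# 13) (# 14) (call OR (v 2 ∷ v 0 ∷ [])))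
                 (case (v 16) nil (case (v 1) nil
                   (cons (v 0) (call STEP (v 17 ∷ v 19 ∷ v 3 ∷ [])))))
                 (binary (# 15) (# 17) (# 18) (call OR (v 0 ∷ call AND (v 2 ∷ v 6 ∷ []) ∷ []))))
body NEXT    = case (v 0) nil (cons
                 (call ASSOC (call STEP (v 3 ∷ v 4 ∷ v 0 ∷ []) ∷ v 5 ∷ v 6 ∷ []))
                 (call NEXT (v 1 ∷ v 3 ∷ v 4 ∷ v 5 ∷ v 6 ∷ [])))
body HEADS   = case (v 0) nil (cons (case (v 0) nil (v 0)) (call HEADS (v 1 ∷ [])))
body TABLE   = case (v 0)
                 (case (v 2) nil (cons (v 0) (call INDEX
                   (call NEXT (v 7 ∷ v 6 ∷
                      call UNION (call REV (v 3 ∷ nil ∷ []) ∷ call EMBED (v 5 ∷ v 0 ∷ []) ∷ []) ∷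
                      v 7 ∷ v 10 ∷ []) ∷
                    v 8 ∷ v 9 ∷ v 1 ∷ []))))
                 (case (v 0)
                   (call TABLE (v 1 ∷ cons nil (v 3) ∷ v 4 ∷ v 5 ∷ v 6 ∷ v 7 ∷ v 8 ∷ v 9 ∷ v 10 ∷ []))
                   (case (v 6) nil (cons
                     (call TABLE (v 5 ∷ cons nil (v 7) ∷ v 0 ∷ v 9 ∷ v 10 ∷ v 11 ∷ v 12 ∷ v 13 ∷ v 14 ∷ []))
                     (call TABLE (v 5 ∷ cons TRUE (v 7) ∷ v 1 ∷ v 9 ∷ v 10 ∷ v 11 ∷ v 12 ∷ v 13 ∷ v 14 ∷ [])))))
body ROWS    = case (v 0) (v 1) (cons
                 (call TABLE (v 4 ∷ nil ∷ v 0 ∷ v 5 ∷ v 6 ∷ v 7 ∷ v 8 ∷ v 9 ∷ v 10 ∷ []))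
                 (call ROWS (v 1 ∷ v 3 ∷ v 4 ∷ v 5 ∷ v 6 ∷ v 7 ∷ v 8 ∷ v 9 ∷ v 10 ∷ [])))
body TRANS   = case (v 0) nil (call ROWS (v 3 ∷
                 call TRANS (v 1 ∷ v 3 ∷ v 4 ∷ v 5 ∷ v 6 ∷ v 7 ∷ v 8 ∷ v 9 ∷ []) ∷
                 v 4 ∷ v 5 ∷ v 6 ∷ v 7 ∷ v 8 ∷ v 9 ∷ v 0 ∷ []))
body COUNT   = case (v 0) nil (call PAD (v 3 ∷ nil ∷ call COUNT (v 1 ∷ v 3 ∷ []) ∷ []))
body FINAL   = case (v 0) nil (call PAD (v 3 ∷ case (v 0) nil (v 0) ∷ call FINAL (v 1 ∷ v 3 ∷ []) ∷ []))

-- case (cons e nil) nil e′ serves as let x₀ = e in e′.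
program : Program 3
program = record
  { functions = 23
  ; arity     = arity
  ; body      = body
  ; main      =
      case (v 0) nil (case (v 1) nil (case (v 1) nil (case (v 1) nil (case (v 1) nil
      (case (cons (call VALS (v 12 ∷ [])) nil) nil
      (case (cons (call BITS (v 0 ∷ [])) nil) nil
      (cons (v 12)
      (cons (v 10)
      (cons (call COUNT (v 0 ∷ v 8 ∷ []))
      (cons (call INDEX (call HEADS (v 2 ∷ []) ∷ v 0 ∷ v 8 ∷ v 6 ∷ []))
      (cons (call TRANS (v 0 ∷ v 4 ∷ v 12 ∷ v 10 ∷ v 16 ∷ v 2 ∷ v 0 ∷ v 8 ∷ []))
            (call FINAL (v 0 ∷ v 8 ∷ [])))))))))))))
  }

open Calls body

-- Correctness of the program, with bounds on the number of calls

NOT⇓ : ∀ p → encBool p ∷ [] ⊢ body NOT ⇓ encBool (not p) # 0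
NOT⇓ true  = case⇓₂ var⇓ nil⇓
NOT⇓ false = case⇓₁ var⇓ (cons⇓ nil⇓ nil⇓)

AND⇓ : ∀ p q → encBool p ∷ encBool q ∷ [] ⊢ body AND ⇓ encBool (p Bool.∧ q) # 0
AND⇓ true  q = case⇓₂ var⇓ var⇓
AND⇓ false q = case⇓₁ var⇓ nil⇓

OR⇓ : ∀ p q → encBool p ∷ encBool q ∷ [] ⊢ body OR ⇓ encBool (p Bool.∨ q) # 0
OR⇓ true  q = case⇓₂ var⇓ (cons⇓ nil⇓ nil⇓)
OR⇓ false q = case⇓₁ var⇓ var⇓

-- The comparison never descends below the first tree. `ASSOC` and `INDEX` pass the sought key
-- first, so the bound does not depend on the list entries.
EQ⇓ : ∀ x y → x ∷ y ∷ [] ⊢ body EQ ⇓ encBool (does (x ≟ y)) # 2 * size x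
EQ⇓ nil     nil     = weaken z≤n (case⇓₁ var⇓ (case⇓₁ var⇓ (cons⇓ nil⇓ nil⇓)))
EQ⇓ nil     (_ ∙ _) = weaken z≤n (case⇓₁ var⇓ (case⇓₂ var⇓ nil⇓))
EQ⇓ (_ ∙ _) nil     = weaken z≤n (case⇓₂ var⇓ (case⇓₁ var⇓ nil⇓))
EQ⇓ (x ∙ x′) (y ∙ y′) with does (x ≟ y) | EQ⇓ x y
... | false | d = weaken (slack (suc (2 * size x′)) (eq (size x) (size x′)))
  (case⇓₂ var⇓ (case⇓₂ var⇓ (case⇓₁ (call⇓ (var⇓ ∷⇓ var⇓ ∷⇓ []⇓) d) nil⇓)))
  where
  eq : ∀ s s′ → suc (2 * s) + 0 + suc (2 * s′) ≡ 2 * suc (s + s′)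
  eq = solve-∀
... | true  | d = weaken (≤-reflexive (eq (size x) (size x′)))
  (case⇓₂ var⇓ (case⇓₂ var⇓ (case⇓₂ (call⇓ (var⇓ ∷⇓ var⇓ ∷⇓ []⇓) d)
    (call⇓ (var⇓ ∷⇓ var⇓ ∷⇓ []⇓) (EQ⇓ x′ y′)))))
  where
  eq : ∀ s s′ → suc (2 * s) + suc (2 * s′) ≡ 2 * suc (s + s′)
  eq = solve-∀

CONSAPP⇓ : ∀ {B D : Set} {e : B → Tree} {e′ : D → Tree} {x} (g : B → D) →
           (∀ y → e′ (g y) ≡ x ∙ e y) → ∀ ys zs →
           x ∷ encList e ys ∷ encList e′ zs ∷ [] ⊢ body CONSAPP ⇓ encList e′ (map g ys ++ zs) # length ys
CONSAPP⇓ g h []       zs = case⇓₁ var⇓ var⇓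
CONSAPP⇓ g h (y ∷ ys) zs rewrite h y =
  case⇓₂ var⇓ (cons⇓ (cons⇓ var⇓ var⇓) (call⇓ (var⇓ ∷⇓ var⇓ ∷⇓ var⇓ ∷⇓ []⇓) (CONSAPP⇓ g h ys zs)))

PROD⇓ : ∀ {A B D : Set} {e : A → Tree} {e′ : B → Tree} {e″ : D → Tree} (g : A → B → D) →
        (∀ x y → e″ (g x y) ≡ e x ∙ e′ y) → ∀ xs ys →
        encList e xs ∷ encList e′ ys ∷ [] ⊢ body PROD ⇓
        encList e″ (cartesianProductWith g xs ys) # length xs * (2 + length ys)
PROD⇓ g h []       ys = case⇓₁ var⇓ nil⇓
PROD⇓ g h (x ∷ xs) ys = weaken (≤-reflexive (eq (length xs * (2 + length ys)) (length ys)))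
  (case⇓₂ var⇓ (call⇓ (var⇓ ∷⇓ var⇓ ∷⇓ call⇓ (var⇓ ∷⇓ var⇓ ∷⇓ []⇓) (PROD⇓ g h xs ys) ∷⇓ []⇓)
    (CONSAPP⇓ (g x) (h x) ys _)))
  where
  eq : ∀ c n → suc (suc c + 0 + n) ≡ 2 + n + c
  eq = solve-∀

length-cartesianProductWith : ∀ {A B D : Set} (g : A → B → D) xs ys →
  length (cartesianProductWith g xs ys) ≡ length xs * length ys
length-cartesianProductWith g []       ys = refl
length-cartesianProductWith g (x ∷ xs) ys = trans (length-++ (map (g x) ys))
  (cong₂ _+_ (length-map (g x) ys) (length-cartesianProductWith g xs ys))

length-vals : ∀ {k} (φ : CoSafety k) → length (vals φ) ≡ 2 * length (rests φ)
length-vals φ = length-cartesianProductWith _,_ bools (rests φ)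

2≤length-vals : ∀ {k} (φ : CoSafety k) → 2 ≤ length (vals φ)
2≤length-vals φ = subst (2 ≤_) (sym (length-vals φ)) (*-monoʳ-≤ 2 1≤length-rests)
  where
  1≤length-rests : 1 ≤ length (rests φ)
  1≤length-rests = subst (λ rs → 1 ≤ length rs) (sym (proj₂ (rests-∷ φ))) (s≤s z≤n)

BOOLS⇓ : ∀ {n} {ρ : Vec Tree n} → ρ ⊢ BOOLS ⇓ encList encBool bools # 0
BOOLS⇓ = cons⇓ nil⇓ (cons⇓ (cons⇓ nil⇓ nil⇓) nil⇓)

pattern skip d = case⇓₂ var⇓ d

-- Kept in the form the evaluation rules produce, zeros included, so that `PAIRS⇓` matches it by
-- computation.
pairsCalls : ℕ → ℕ → ℕ
pairsCalls m n = suc (suc (6 * m) + (suc (6 * n) + 0) + m * (2 + n))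

-- The left-hand side is `8 + 8 * m + 6 * n + m * n`. For factors of at least 2 the first three
-- terms are at most 2, 4 and 3 times `m * n`, whence the 10.
pairsCalls-bound : ∀ {l m n} → l ≡ m * n → 2 ≤ m → 2 ≤ n → 5 + pairsCalls m n ≤ 10 * l
pairsCalls-bound {m = m} {n} refl 2≤m 2≤n = begin
  5 + pairsCalls m n
    ≡⟨ eq m n ⟩
  2 * (2 * 2) + 4 * (m * 2) + 3 * (2 * n) + m * n
    ≤⟨ +-monoˡ-≤ (m * n) (+-mono-≤ (+-mono-≤ (*-monoʳ-≤ 2 (*-mono-≤ 2≤m 2≤n))
         (*-monoʳ-≤ 4 (*-monoʳ-≤ m 2≤n))) (*-monoʳ-≤ 3 (*-monoˡ-≤ n 2≤m))) ⟩
  2 * (m * n) + 4 * (m * n) + 3 * (m * n) + m * n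
    ≡⟨ eq′ (m * n) ⟩
  10 * (m * n) ∎
  where
  open ≤-Reasoning
  eq : ∀ m n → 5 + suc (suc (6 * m) + (suc (6 * n) + 0) + m * (2 + n)) ≡
               2 * (2 * 2) + 4 * (m * 2) + 3 * (2 * n) + m * n
  eq = solve-∀
  eq′ : ∀ p → 2 * p + 4 * p + 3 * p + p ≡ 10 * p
  eq′ = solve-∀

pairs-bound : ∀ {k} (φ ψ : CoSafety k) → 5 + pairsCalls (length (vals φ)) (length (vals ψ)) ≤
              10 * length (cartesianProduct (vals φ) (vals ψ))
pairs-bound φ ψ = pairsCalls-bound (length-cartesianProductWith _,_ (vals φ) (vals ψ))
                                   (2≤length-vals φ) (2≤length-vals ψ)

next-bound : ∀ {n} → 2 ≤ n → 5 + suc (6 * n) ≤ 10 * n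
next-bound {n} 2≤n = begin
  5 + suc (6 * n)    ≡⟨ eq n ⟩
  3 * 2 + 6 * n      ≤⟨ +-monoˡ-≤ (6 * n) (*-mono-≤ (n≤1+n 3) 2≤n) ⟩
  4 * n + 6 * n      ≡⟨ eq′ n ⟩
  10 * n             ∎
  where
  open ≤-Reasoning
  eq : ∀ n → 5 + suc (6 * n) ≡ 3 * 2 + 6 * n
  eq = solve-∀
  eq′ : ∀ n → 4 * n + 6 * n ≡ 10 * n
  eq′ = solve-∀

vals-bound : ∀ {m n} c → m ≡ 2 * n → 5 + c ≤ 10 * n → suc (c + 0 + 2 * (2 + n)) ≤ 6 * m
vals-bound {n = n} c refl c≤ = begin
  suc (c + 0 + 2 * (2 + n))  ≡⟨ eq c n ⟩
  5 + c + 2 * n              ≤⟨ +-monoˡ-≤ (2 * n) c≤ ⟩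
  10 * n + 2 * n             ≡⟨ eq′ n ⟩
  6 * (2 * n)                ∎
  where
  open ≤-Reasoning
  eq : ∀ c n → suc (c + 0 + 2 * (2 + n)) ≡ 5 + c + 2 * n
  eq = solve-∀
  eq′ : ∀ n → 10 * n + 2 * n ≡ 6 * (2 * n)
  eq′ = solve-∀

mutual

  -- The cost is linear in the length of the result, because the number of valuations at least
  -- doubles with every operator and absorbs the work done below.
  VALS⇓ : ∀ {k} (φ : CoSafety k) →
          encCoSafety φ ∷ [] ⊢ body VALS ⇓ encList (encVal φ) (vals φ) # 6 * length (vals φ)
  VALS⇓ φ =
    let c , c≤ , d = RESTS⇓ φ
    in weaken (vals-bound c (length-vals φ) c≤)
         (call⇓ (BOOLS⇓ ∷⇓ d ∷⇓ []⇓) (PROD⇓ _,_ (λ _ _ → refl) bools (rests φ)))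

  PAIRS⇓ : ∀ {k n} (φ ψ : CoSafety k) {ρ : Vec Tree n} {x} →
           lookup ρ x ≡ encCoSafety φ ∙ encCoSafety ψ →
           ρ ⊢ pairs x ⇓ encList (λ (v , w) → encVal φ v ∙ encVal ψ w) (cartesianProduct (vals φ) (vals ψ))
             # pairsCalls (length (vals φ)) (length (vals ψ))
  PAIRS⇓ φ ψ eq =
    case⇓₂ (convert eq var⇓)
      (call⇓ (call⇓ (var⇓ ∷⇓ []⇓) (VALS⇓ φ) ∷⇓ call⇓ (var⇓ ∷⇓ []⇓) (VALS⇓ ψ) ∷⇓ []⇓)
        (PROD⇓ _,_ (λ _ _ → refl) (vals φ) (vals ψ)))

  -- The reserve of 5 pays for the call of `PROD` in `VALS` and the constant part of its cost
  -- `2 * (2 + n)`; then `10 * n + 2 * n = 6 * (2 * n)` closes the induction.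
  RESTS⇓ : ∀ {k} (φ : CoSafety k) → ∃[ c ] 5 + c ≤ 10 * length (rests φ) ×
           encCoSafety φ ∷ [] ⊢ restsOf ⇓ encList (encRest φ) (rests φ) # c
  RESTS⇓ tt        = _ , m≤m+n 5 5 , case⇓₂ var⇓ (case⇓₁ var⇓ (cons⇓ nil⇓ nil⇓))
  RESTS⇓ ff        = _ , m≤m+n 5 5 , case⇓₂ var⇓ (skip (case⇓₁ var⇓ (cons⇓ nil⇓ nil⇓)))
  RESTS⇓ (atom e)  = _ , m≤m+n 5 5 , case⇓₂ var⇓ (skip (skip (case⇓₁ var⇓ (cons⇓ nil⇓ nil⇓))))
  RESTS⇓ (¬atom e) = _ , m≤m+n 5 5 , case⇓₂ var⇓ (skip (skip (skip (case⇓₁ var⇓ (cons⇓ nil⇓ nil⇓)))))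
  RESTS⇓ (φ ∧ ψ)   = _ , pairs-bound φ ψ ,
    case⇓₂ var⇓ (skip (skip (skip (skip (case⇓₁ var⇓ (PAIRS⇓ φ ψ refl))))))
  RESTS⇓ (φ ∨ ψ)   = _ , pairs-bound φ ψ ,
    case⇓₂ var⇓ (skip (skip (skip (skip (skip (case⇓₁ var⇓ (PAIRS⇓ φ ψ refl)))))))
  RESTS⇓ (X φ)     = _ , next-bound (2≤length-vals φ) ,
    case⇓₂ var⇓ (skip (skip (skip (skip (skip (skip (case⇓₁ var⇓
      (call⇓ (var⇓ ∷⇓ []⇓) (VALS⇓ φ)))))))))
  RESTS⇓ (φ U ψ)   = _ , pairs-bound φ ψ ,
    case⇓₂ var⇓ (skip (skip (skip (skip (skip (skip (skip (PAIRS⇓ φ ψ refl))))))))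

length-bits : ∀ {A : Set} (xs : List A) → length (bits xs) ≡ 2 ^ length xs
length-bits []       = refl
length-bits (x ∷ xs) = trans (length-cartesianProductWith _∷_ bools (bits xs))
  (cong (2 *_) (length-bits xs))

-- This is `10 * n + 6 ≤ 16 * n`: doubling the list absorbs the cost of the shorter one.
bits-bound : ∀ {m n} → m ≡ 2 * n → 1 ≤ n → suc (suc (8 * n) + 0 + 2 * (2 + n)) ≤ 8 * m
bits-bound refl (s≤s {n = n} _) = slack (6 * n) (eq n)
  where
  eq : ∀ n → suc (suc (8 * suc n) + 0 + 2 * (2 + suc n)) + 6 * n ≡ 8 * (2 * suc n)
  eq = solve-∀

BITS⇓ : ∀ {A : Set} (e : A → Tree) xs →
        encList e xs ∷ [] ⊢ body BITS ⇓ encList encBits (bits xs) # 8 * length (bits xs)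
BITS⇓ e []       = weaken z≤n (case⇓₁ var⇓ (cons⇓ nil⇓ nil⇓))
BITS⇓ e (x ∷ xs) = weaken
  (bits-bound (length-cartesianProductWith _∷_ bools (bits xs))
    (subst (1 ≤_) (sym (length-bits xs)) (m^n>0 2 (length xs))))
  (case⇓₂ var⇓ (call⇓ (BOOLS⇓ ∷⇓ call⇓ (var⇓ ∷⇓ []⇓) (BITS⇓ e xs) ∷⇓ []⇓)
    (PROD⇓ _∷_ (λ _ _ → refl) bools (bits xs))))

ASSOC⇓ : ∀ {A : Set} (e : A → Tree) x ys bs →
         e x ∷ encList e ys ∷ encBits bs ∷ [] ⊢ body ASSOC ⇓
         encBool (assoc e x ys bs) # length ys * (2 * size (e x) + 2)
ASSOC⇓ e x []       bs       = case⇓₁ var⇓ nil⇓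
ASSOC⇓ e x (y ∷ ys) []       = weaken z≤n (case⇓₂ var⇓ (case⇓₁ var⇓ nil⇓))
ASSOC⇓ e x (y ∷ ys) (b ∷ bs) with does (e x ≟ e y) | EQ⇓ (e x) (e y)
... | true  | d = weaken (slack _ (eq (2 * size (e x)) (length ys * (2 * size (e x) + 2))))
  (case⇓₂ var⇓ (case⇓₂ var⇓ (case⇓₂ (call⇓ (var⇓ ∷⇓ var⇓ ∷⇓ []⇓) d) var⇓)))
  where
  eq : ∀ s c → suc s + 0 + (1 + c) ≡ s + 2 + c
  eq = solve-∀
... | false | d = weaken (≤-reflexive (eq (2 * size (e x)) (length ys * (2 * size (e x) + 2))))
  (case⇓₂ var⇓ (case⇓₂ var⇓ (case⇓₁ (call⇓ (var⇓ ∷⇓ var⇓ ∷⇓ []⇓) d)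
    (call⇓ (var⇓ ∷⇓ var⇓ ∷⇓ var⇓ ∷⇓ []⇓) (ASSOC⇓ e x ys bs)))))
  where
  eq : ∀ s c → suc s + suc c ≡ s + 2 + c
  eq = solve-∀

pad : ℕ → Tree → Tree → Tree
pad zero    b t = t
pad (suc n) b t = b ∙ pad n b t

pad-encℕ : ∀ m n → pad m nil (encℕ n) ≡ encℕ (m + n)
pad-encℕ zero    n = refl
pad-encℕ (suc m) n = cong (nil ∙_) (pad-encℕ m n)

PAD⇓ : ∀ n b t → encℕ n ∷ b ∷ t ∷ [] ⊢ body PAD ⇓ pad n b t # n
PAD⇓ zero    b t = case⇓₁ var⇓ var⇓
PAD⇓ (suc n) b t = case⇓₂ var⇓ (cons⇓ var⇓ (call⇓ (var⇓ ∷⇓ var⇓ ∷⇓ var⇓ ∷⇓ []⇓) (PAD⇓ n b t)))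

-- `combine i s` is the number `i * n + s`. In unary, every entry skipped on the way to `f` pads the
-- result by `n`, and the match contributes `s`.
INDEX⇓ : ∀ {n f fs} (f∈ : f ∈ fs) (s : Fin n) →
         encBits f ∷ encList encBits fs ∷ encℕ n ∷ encFin s ∷ [] ⊢ body INDEX ⇓
         encFin (combine (position f∈) s) # length fs * (2 * size (encBits f) + n + 3)
INDEX⇓ {n} {f} {g ∷ fs} f∈ s with encBits f ≟ encBits g | EQ⇓ (encBits f) (encBits g)
... | yes _ | d rewrite toℕ-↑ˡ s (length fs * n) =
  weaken (slack _ (eq (2 * size (encBits f)) n (length fs * (2 * size (encBits f) + n + 3))))
    (case⇓₂ var⇓ (case⇓₂ (call⇓ (var⇓ ∷⇓ var⇓ ∷⇓ []⇓) d) var⇓))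
  where
  eq : ∀ s n c → suc s + 0 + (n + 2 + c) ≡ s + n + 3 + c
  eq = solve-∀
... | no ¬e | d
  rewrite toℕ-↑ʳ n (combine (position (tail (¬e ∘ cong encBits) f∈)) s)
        | sym (pad-encℕ n (toℕ (combine (position (tail (¬e ∘ cong encBits) f∈)) s))) =
  weaken (≤-reflexive (eq (2 * size (encBits f)) n (length fs * (2 * size (encBits f) + n + 3))))
    (case⇓₂ var⇓ (case⇓₁ (call⇓ (var⇓ ∷⇓ var⇓ ∷⇓ []⇓) d)
      (call⇓ (var⇓ ∷⇓ nil⇓ ∷⇓ call⇓ (var⇓ ∷⇓ var⇓ ∷⇓ var⇓ ∷⇓ var⇓ ∷⇓ []⇓)
               (INDEX⇓ (tail (¬e ∘ cong encBits) f∈) s) ∷⇓ []⇓)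
        (PAD⇓ n nil _))))
  where
  eq : ∀ s n c → suc s + suc (suc c + 0 + n) ≡ s + n + 3 + c
  eq = solve-∀

EMBED⇓ : ∀ {k} (p : Subset k) I →
         encSubset p ∷ encSubset I ∷ [] ⊢ body EMBED ⇓ encSubset (embed p I) # k
EMBED⇓ []            []      = case⇓₁ var⇓ nil⇓
EMBED⇓ (outside ∷ p) I       =
  case⇓₂ var⇓ (case⇓₁ var⇓ (cons⇓ nil⇓ (call⇓ (var⇓ ∷⇓ var⇓ ∷⇓ []⇓) (EMBED⇓ p I))))
EMBED⇓ (inside  ∷ p) (b ∷ I) =
  case⇓₂ var⇓ (case⇓₂ var⇓ (case⇓₂ var⇓ (cons⇓ var⇓ (call⇓ (var⇓ ∷⇓ var⇓ ∷⇓ []⇓) (EMBED⇓ p I)))))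

UNION⇓ : ∀ {k} (a b : Subset k) →
         encSubset a ∷ encSubset b ∷ [] ⊢ body UNION ⇓ encSubset (a ∪ b) # 2 * k
UNION⇓ []      []      = case⇓₁ var⇓ nil⇓
UNION⇓ {suc k} (x ∷ a) (y ∷ b) = weaken (≤-reflexive (eq k)) (case⇓₂ var⇓ (case⇓₂ var⇓
  (cons⇓ (call⇓ (var⇓ ∷⇓ var⇓ ∷⇓ []⇓) (OR⇓ x y)) (call⇓ (var⇓ ∷⇓ var⇓ ∷⇓ []⇓) (UNION⇓ a b)))))
  where
  eq : ∀ k → 1 + suc (2 * k) ≡ 2 * suc k
  eq = solve-∀

REV⇓ : ∀ xs ys → encBits xs ∷ encBits ys ∷ [] ⊢ body REV ⇓ encBits (xs ʳ++ ys) # length xs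
REV⇓ []       ys = case⇓₁ var⇓ var⇓
REV⇓ (x ∷ xs) ys = case⇓₂ var⇓ (call⇓ (var⇓ ∷⇓ cons⇓ var⇓ var⇓ ∷⇓ []⇓) (REV⇓ xs (x ∷ ys)))

NTH⇓ : ∀ {k} (e : Fin k) (a : Subset k) →
       encFin e ∷ encSubset a ∷ [] ⊢ body NTH ⇓ encBool (lookup a e) # k
NTH⇓ zero    (x ∷ a) = weaken z≤n (case⇓₂ var⇓ (case⇓₁ var⇓ var⇓))
NTH⇓ (suc e) (x ∷ a) = case⇓₂ var⇓ (case⇓₂ var⇓ (call⇓ (var⇓ ∷⇓ var⇓ ∷⇓ []⇓) (NTH⇓ e a)))

-- Per symbol, an atom needs up to `k` calls in `NTH`, and an until four of its own: two of `STEP`,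
-- one of `AND` and one of `OR`.
STEP⇓ : ∀ {k} (φ : CoSafety k) a w →
        encCoSafety φ ∷ encSubset a ∷ encVal φ w ∷ [] ⊢ body STEP ⇓
        encVal φ (step φ a w) # lenCoSafety φ * (4 + k)
STEP⇓ tt        a w = weaken z≤n (case⇓₂ var⇓ (case⇓₁ var⇓ (cons⇓ (cons⇓ nil⇓ nil⇓) nil⇓)))
STEP⇓ ff        a w = weaken z≤n (case⇓₂ var⇓ (skip (case⇓₁ var⇓ (cons⇓ nil⇓ nil⇓))))
STEP⇓ {k} (atom e)  a w = weaken (slack 3 (eq k)) (case⇓₂ var⇓ (skip (skip (case⇓₁ var⇓
  (cons⇓ (call⇓ (var⇓ ∷⇓ var⇓ ∷⇓ []⇓) (NTH⇓ e a)) nil⇓)))))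
  where
  eq : ∀ k → suc k + 0 + 3 ≡ 1 * (4 + k)
  eq = solve-∀
STEP⇓ {k} (¬atom e) a w = weaken (slack (6 + k) (eq k)) (case⇓₂ var⇓ (skip (skip (skip (case⇓₁ var⇓
  (cons⇓ (call⇓ (call⇓ (var⇓ ∷⇓ var⇓ ∷⇓ []⇓) (NTH⇓ e a) ∷⇓ []⇓) (NOT⇓ (lookup a e))) nil⇓))))))
  where
  eq : ∀ k → suc (suc k + 0 + 0) + 0 + (6 + k) ≡ 2 * (4 + k)
  eq = solve-∀
STEP⇓ {k} (φ ∧ ψ)   a (b , w , w′) = weaken (slack (1 + k) (eq (lenCoSafety φ) (lenCoSafety ψ) k))
  (case⇓₂ var⇓ (skip (skip (skip (skip (case⇓₁ var⇓
    (case⇓₂ var⇓ (case⇓₂ var⇓ (case⇓₂ var⇓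
    (case⇓₂ (call⇓ (var⇓ ∷⇓ var⇓ ∷⇓ var⇓ ∷⇓ []⇓) (STEP⇓ φ a w))
    (case⇓₂ (call⇓ (var⇓ ∷⇓ var⇓ ∷⇓ var⇓ ∷⇓ []⇓) (STEP⇓ ψ a w′))
    (cons⇓ (call⇓ (var⇓ ∷⇓ var⇓ ∷⇓ []⇓) (AND⇓ (proj₁ (step φ a w)) (proj₁ (step ψ a w′))))
           (cons⇓ (cons⇓ var⇓ var⇓) (cons⇓ var⇓ var⇓))))))))))))))
  where
  eq : ∀ l m k → suc (l * (4 + k)) + (suc (m * (4 + k)) + 1) + (1 + k) ≡ suc (l + m) * (4 + k)
  eq = solve-∀
STEP⇓ {k} (φ ∨ ψ)   a (b , w , w′) = weaken (slack (1 + k) (eq (lenCoSafety φ) (lenCoSafety ψ) k))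
  (case⇓₂ var⇓ (skip (skip (skip (skip (skip (case⇓₁ var⇓
    (case⇓₂ var⇓ (case⇓₂ var⇓ (case⇓₂ var⇓
    (case⇓₂ (call⇓ (var⇓ ∷⇓ var⇓ ∷⇓ var⇓ ∷⇓ []⇓) (STEP⇓ φ a w))
    (case⇓₂ (call⇓ (var⇓ ∷⇓ var⇓ ∷⇓ var⇓ ∷⇓ []⇓) (STEP⇓ ψ a w′))
    (cons⇓ (call⇓ (var⇓ ∷⇓ var⇓ ∷⇓ []⇓) (OR⇓ (proj₁ (step φ a w)) (proj₁ (step ψ a w′))))
           (cons⇓ (cons⇓ var⇓ var⇓) (cons⇓ var⇓ var⇓)))))))))))))))
  where
  eq : ∀ l m k → suc (l * (4 + k)) + (suc (m * (4 + k)) + 1) + (1 + k) ≡ suc (l + m) * (4 + k)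
  eq = solve-∀
STEP⇓ {k} (X φ)     a (b , w)      = weaken (slack (3 + k) (eq (lenCoSafety φ) k))
  (case⇓₂ var⇓ (skip (skip (skip (skip (skip (skip (case⇓₁ var⇓
    (case⇓₂ var⇓ (case⇓₂ var⇓
    (cons⇓ var⇓ (call⇓ (var⇓ ∷⇓ var⇓ ∷⇓ var⇓ ∷⇓ []⇓) (STEP⇓ φ a w)))))))))))))
  where
  eq : ∀ l k → suc (l * (4 + k)) + (3 + k) ≡ suc l * (4 + k)
  eq = solve-∀
STEP⇓ {k} (φ U ψ)   a (b , w , w′) = weaken (slack k (eq (lenCoSafety φ) (lenCoSafety ψ) k))
  (case⇓₂ var⇓ (skip (skip (skip (skip (skip (skip (skip
    (case⇓₂ var⇓ (case⇓₂ var⇓ (case⇓₂ var⇓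
    (case⇓₂ (call⇓ (var⇓ ∷⇓ var⇓ ∷⇓ var⇓ ∷⇓ []⇓) (STEP⇓ φ a w))
    (case⇓₂ (call⇓ (var⇓ ∷⇓ var⇓ ∷⇓ var⇓ ∷⇓ []⇓) (STEP⇓ ψ a w′))
    (cons⇓ (call⇓ (var⇓ ∷⇓ call⇓ (var⇓ ∷⇓ var⇓ ∷⇓ []⇓) (AND⇓ (proj₁ (step φ a w)) b) ∷⇓ []⇓)
                  (OR⇓ (proj₁ (step ψ a w′)) (proj₁ (step φ a w) Bool.∧ b)))
           (cons⇓ (cons⇓ var⇓ var⇓) (cons⇓ var⇓ var⇓))))))))))))))))
  where
  eq : ∀ l m k → suc (l * (4 + k)) + (suc (m * (4 + k)) + 2) + k ≡ suc (l + m) * (4 + k)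
  eq = solve-∀

size-encBool : ∀ b → size (encBool b) ≤ 3
size-encBool true  = ≤-refl
size-encBool false = s≤s z≤n

mutual

  -- Five per symbol: a node, a bit of size at most 3, and the node or leaf that holds the rest.
  size-encVal : ∀ {k} (φ : CoSafety k) w → size (encVal φ w) ≤ 5 * lenCoSafety φ
  size-encVal φ (b , r) = ≤-trans (s≤s (+-monoˡ-≤ _ (size-encBool b))) (size-encRest φ r)

  size-pair : ∀ {k} (φ ψ : CoSafety k) w w′ →
              5 + (size (encVal φ w) + size (encVal ψ w′)) ≤ 5 * suc (lenCoSafety φ + lenCoSafety ψ)
  size-pair φ ψ w w′ = ≤-trans (+-monoʳ-≤ 5 (+-mono-≤ (size-encVal φ w) (size-encVal ψ w′)))
    (≤-reflexive (eq (lenCoSafety φ) (lenCoSafety ψ)))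
    where
    eq : ∀ l m → 5 + (5 * l + 5 * m) ≡ 5 * suc (l + m)
    eq = solve-∀

  size-encRest : ∀ {k} (φ : CoSafety k) r → 4 + size (encRest φ r) ≤ 5 * lenCoSafety φ
  size-encRest tt        r        = ≤-refl
  size-encRest ff        r        = ≤-refl
  size-encRest (atom e)  r        = ≤-refl
  size-encRest (¬atom e) r        = m≤m+n 5 5
  size-encRest (φ ∧ ψ)   (w , w′) = size-pair φ ψ w w′
  size-encRest (φ ∨ ψ)   (w , w′) = size-pair φ ψ w w′
  size-encRest (X φ)     w        = ≤-trans (+-mono-≤ (n≤1+n 4) (size-encVal φ w))
    (≤-reflexive (eq (lenCoSafety φ)))
    where
    eq : ∀ l → 5 + 5 * l ≡ 5 * suc l
    eq = solve-∀
  size-encRest (φ U ψ)   (w , w′) = size-pair φ ψ w w′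

size-encBits : ∀ f → size (encBits f) ≤ 1 + 4 * length f
size-encBits []      = ≤-refl
size-encBits (b ∷ f) = ≤-trans (s≤s (+-mono-≤ (size-encBool b) (size-encBits f)))
  (≤-reflexive (eq (length f)))
  where
  eq : ∀ n → suc (3 + (1 + 4 * n)) ≡ 1 + 4 * suc n
  eq = solve-∀

-- Calls per element of NEXT, and per leaf of TABLE.

nextCalls : (k l V : ℕ) → ℕ
nextCalls k l V = 3 + (l * (4 + k) + V * (2 * (5 * l) + 2))

leafCalls : (k l V S N : ℕ) → ℕ
leafCalls k l V S N = 5 + (4 * k + (V * nextCalls k l V + S * (2 * (1 + 4 * V) + N + 3)))

NEXT⇓ : ∀ {k} (φ : CoSafety k) a f vs →
        encList (encVal φ) vs ∷ encCoSafety φ ∷ encSubset a ∷ encList (encVal φ) (vals φ) ∷ encBits f ∷ []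
        ⊢ body NEXT ⇓ encBits (map (λ w → assoc (encVal φ) (step φ a w) (vals φ) f) vs)
        # length vs * nextCalls k (lenCoSafety φ) (length (vals φ))
NEXT⇓ φ a f []       = case⇓₁ var⇓ nil⇓
NEXT⇓ {k} φ a f (w ∷ vs) = weaken
  (bound {l = lenCoSafety φ} (length (vals φ)) (length vs * nextCalls k (lenCoSafety φ) (length (vals φ)))
    (size-encVal φ (step φ a w)))
  (case⇓₂ var⇓ (cons⇓
    (call⇓ (call⇓ (var⇓ ∷⇓ var⇓ ∷⇓ var⇓ ∷⇓ []⇓) (STEP⇓ φ a w) ∷⇓ var⇓ ∷⇓ var⇓ ∷⇓ []⇓)
      (ASSOC⇓ (encVal φ) (step φ a w) (vals φ) f))
    (call⇓ (var⇓ ∷⇓ var⇓ ∷⇓ var⇓ ∷⇓ var⇓ ∷⇓ var⇓ ∷⇓ []⇓) (NEXT⇓ φ a f vs))))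
  where
  eq : ∀ t u c → suc (suc t + 0 + u) + suc c ≡ 3 + (t + u) + c
  eq = solve-∀
  bound : ∀ {s l} V c → s ≤ 5 * l →
          suc (suc (l * (4 + k)) + 0 + V * (2 * s + 2)) + suc c ≤ nextCalls k l V + c
  bound {s} {l} V c s≤ = ≤-trans (≤-reflexive (eq (l * (4 + k)) (V * (2 * s + 2)) c))
    (+-monoˡ-≤ c (+-monoʳ-≤ 3 (+-monoʳ-≤ (l * (4 + k)) (*-monoʳ-≤ V (+-monoˡ-≤ 2 (*-monoʳ-≤ 2 s≤))))))

HEADS⇓ : ∀ {k} (φ : CoSafety k) vs →
         encList (encVal φ) vs ∷ [] ⊢ body HEADS ⇓ encBits (map proj₁ vs) # length vs
HEADS⇓ φ []       = case⇓₁ var⇓ nil⇓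
HEADS⇓ φ (w ∷ vs) =
  case⇓₂ var⇓ (cons⇓ (case⇓₂ var⇓ var⇓) (call⇓ (var⇓ ∷⇓ []⇓) (HEADS⇓ φ vs)))

encBits-toList : ∀ {k} (a : Subset k) → encBits (toList a) ≡ encSubset a
encBits-toList []      = refl
encBits-toList (x ∷ a) = cong (encBool x ∙_) (encBits-toList a)

REV-toList⇓ : ∀ {k} xs (a : Subset k) → toList a ≡ xs ʳ++ [] →
              encBits xs ∷ nil ∷ [] ⊢ body REV ⇓ encSubset a # k
REV-toList⇓ xs a eq = subst₂ (λ t c → encBits xs ∷ nil ∷ [] ⊢ body REV ⇓ t # c)
  (trans (cong encBits (sym eq)) (encBits-toList a))
  (begin
    length xs          ≡⟨ sym (+-identityʳ _) ⟩
    length xs + 0      ≡⟨ sym (length-ʳ++ xs) ⟩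
    length (xs ʳ++ []) ≡⟨ cong length (sym eq) ⟩
    length (toList a)  ≡⟨ length-toList a ⟩
    _                  ∎)
  (REV⇓ xs [])
  where open ≡-Reasoning

-- Tables of the product machine as trees

encStep : ∀ {m n} → Subset m × Fin n → Tree
encStep (O , s) = encSubset O ∙ encFin s

encOnto : ∀ {A : Set} {n} → (A → Tree) → Vec A n → Tree → Tree
encOnto e []       t = t
encOnto e (x ∷ xs) t = e x ∙ encOnto e xs t

1≤size : ∀ t → 1 ≤ size t
1≤size nil     = s≤s z≤n
1≤size (_ ∙ _) = s≤s z≤n

-- The layout of a table indexed by product states: `combine` numbers the pairs with the same
-- monitor state consecutively.
blocks : ∀ {A : Set} {n} → (A → Tree) → (List Bool → Fin n → A) → List (List Bool) → Tree
blocks e g []       = nil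
blocks e g (f ∷ fs) = encOnto e (tabulate (g f)) (blocks e g fs)

COUNT⇓ : ∀ (fs : List (List Bool)) n →
         encList encBits fs ∷ encℕ n ∷ [] ⊢ body COUNT ⇓ encℕ (length fs * n) # length fs * (2 + n)
COUNT⇓ []       n = case⇓₁ var⇓ nil⇓
COUNT⇓ (f ∷ fs) n = convert (pad-encℕ n (length fs * n))
  (weaken (≤-reflexive (eq (length fs * (2 + n)) n))
    (case⇓₂ var⇓ (call⇓ (var⇓ ∷⇓ nil⇓ ∷⇓ call⇓ (var⇓ ∷⇓ var⇓ ∷⇓ []⇓) (COUNT⇓ fs n) ∷⇓ []⇓) (PAD⇓ n nil _))))
  where
  eq : ∀ c n → suc (suc c + 0 + n) ≡ 2 + n + c
  eq = solve-∀

pad-encOnto : ∀ n b t → pad n (encBool b) t ≡ encOnto encBool (tabulate {n = n} λ _ → b) t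
pad-encOnto zero    b t = refl
pad-encOnto (suc n) b t = cong (encBool b ∙_) (pad-encOnto n b t)

accepting⇓ : ∀ {n} {ρ : Vec Tree n} f →
             encBits f ∷ ρ ⊢ case (v 0) nil (v 0) ⇓ encBool (accepting f) # 0
accepting⇓ []      = case⇓₁ var⇓ nil⇓
accepting⇓ (b ∷ f) = case⇓₂ var⇓ var⇓

FINAL⇓ : ∀ fs n → encList encBits fs ∷ encℕ n ∷ [] ⊢ body FINAL ⇓
         blocks {n = n} encBool (λ f _ → accepting f) fs # length fs * (2 + n)
FINAL⇓ []       n = case⇓₁ var⇓ nil⇓
FINAL⇓ (f ∷ fs) n = convert (pad-encOnto n (accepting f) _)
  (weaken (≤-reflexive (eq (length fs * (2 + n)) n))
    (case⇓₂ var⇓ (call⇓ (var⇓ ∷⇓ accepting⇓ f ∷⇓ call⇓ (var⇓ ∷⇓ var⇓ ∷⇓ []⇓) (FINAL⇓ fs n) ∷⇓ []⇓)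
      (PAD⇓ n (encBool (accepting f)) _))))
  where
  eq : ∀ c n → suc (suc c + 0 + n) ≡ 2 + n + c
  eq = solve-∀

encVec-tabulate-+ : ∀ {A : Set} (e : A → Tree) m {n} (h : Fin (m + n) → A) →
  encVec e (tabulate h) ≡ encOnto e (tabulate (h ∘ (_↑ˡ n))) (encVec e (tabulate (h ∘ (m ↑ʳ_))))
encVec-tabulate-+ e zero    h = refl
encVec-tabulate-+ e (suc m) h = cong (e (h zero) ∙_) (encVec-tabulate-+ e m (h ∘ suc))

encVec-blocks : ∀ {A : Set} (e : A → Tree) {n} (g : List Bool → Fin n → A) fs (h : Fin (length fs * n) → A) →
                (∀ i j → h (combine i j) ≡ g (List.lookup fs i) j) →
                encVec e (tabulate h) ≡ blocks e g fs
encVec-blocks e     g []       h eq = refl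
encVec-blocks e {n} g (f ∷ fs) h eq = trans (encVec-tabulate-+ e n h)
  (cong₂ (encOnto e) (tabulate-cong (eq zero))
    (encVec-blocks e g fs (h ∘ (n ↑ʳ_)) (λ i j → eq (suc i) j)))

-- The unsimplified sum in the order of the derivation, so that `main⇓` matches it by computation.
totalCalls : (k l V S N R : ℕ) → ℕ
totalCalls k l V S N R =
  suc (6 * V) + 0 + (suc (8 * S) + 0 + (suc (S * (2 + N)) +
    (suc (suc V + 0 + S * (2 * (1 + 4 * V) + N + 3)) +
    (suc (S * (2 + R * (2 + (k + leafCalls k l V S N)))) + suc (S * (2 + N))))))

module _ {k} {Pin Pout : Subset k} (φ : CoSafety k) (C : Mealy Pin Pout) where
  open Mealy C renaming (trans to δ)
  open Product φ C

  private
    l = lenCoSafety φ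
    V = length (vals φ)
    S = length (Monitor φ)
    L = leafCalls k l V S states

  LEAF⇓ : ∀ acc (a : Letter k) f O (s : Fin states) → toList a ≡ acc ʳ++ [] →
          nil ∷ encBits acc ∷ encStep (O , s) ∷ encSubset Pout ∷ encCoSafety φ ∷
          encList (encVal φ) (vals φ) ∷ encList encBits (Monitor φ) ∷ encℕ states ∷ encBits f ∷ []
          ⊢ body TABLE ⇓ encStep (target f a (O , s)) # L
  LEAF⇓ acc a f O s eq = weaken (bound (length-map _ (vals φ)))
    (case⇓₁ var⇓ (case⇓₂ var⇓ (cons⇓ var⇓ (call⇓
      (call⇓ (var⇓ ∷⇓ var⇓ ∷⇓
              call⇓ (call⇓ (var⇓ ∷⇓ nil⇓ ∷⇓ []⇓) (REV-toList⇓ acc a eq) ∷⇓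
                     call⇓ (var⇓ ∷⇓ var⇓ ∷⇓ []⇓) (EMBED⇓ Pout O) ∷⇓ []⇓)
                (UNION⇓ a (embed Pout O)) ∷⇓
              var⇓ ∷⇓ var⇓ ∷⇓ []⇓)
        (NEXT⇓ φ (a ∪ embed Pout O) f (vals φ)) ∷⇓
       var⇓ ∷⇓ var⇓ ∷⇓ var⇓ ∷⇓ []⇓)
      (INDEX⇓ (next∈Monitor φ (a ∪ embed Pout O) f) s)))))
    where
    f′ = next φ (a ∪ embed Pout O) f
    eqU : ∀ k n i → suc (suc (suc (suc k + (suc k + 0) + 2 * k) + 0 + n) + 0 + i) ≡ 5 + (4 * k + (n + i))
    eqU = solve-∀
    bound : length f′ ≡ V →
      suc (suc (suc (suc k + (suc k + 0) + 2 * k) + 0 + V * nextCalls k l V) + 0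
           + S * (2 * size (encBits f′) + states + 3)) ≤ L
    bound eq′ = ≤-trans
      (≤-reflexive (eqU k (V * nextCalls k l V) (S * (2 * size (encBits f′) + states + 3))))
      (+-monoʳ-≤ 5 (+-monoʳ-≤ (4 * k) (+-monoʳ-≤ (V * nextCalls k l V)
        (*-monoʳ-≤ S (+-monoˡ-≤ 3 (+-monoˡ-≤ states (*-monoʳ-≤ 2
          (subst (λ n → size (encBits f′) ≤ 1 + 4 * n) eq′ (size-encBits f′)))))))))

  -- `a` gives the whole letter as a function of the input bits still open, `acc` the decided part
  -- in reverse; comparing lists avoids arithmetic on vector lengths. The summand `j` in the bound
  -- pays for positions outside `p`, at which the recursion proceeds without descending in the
  -- table.
  TABLE⇓ : ∀ {j} (p : Subset j) acc f (h : Sub p → Sub Pout × Fin states) (a : Sub p → Letter k) →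
           (∀ I → toList (a I) ≡ acc ʳ++ toList (embed p I)) →
           encSubset p ∷ encBits acc ∷ encTable ∣ p ∣ encStep h ∷ encSubset Pout ∷ encCoSafety φ ∷
           encList (encVal φ) (vals φ) ∷ encList encBits (Monitor φ) ∷ encℕ states ∷ encBits f ∷ []
           ⊢ body TABLE ⇓ encTable ∣ p ∣ encStep (λ I → target f (a I) (h I))
           # size (encTable ∣ p ∣ encStep h) * (j + L)
  TABLE⇓ [] acc f h a eq = weaken
    (≤-trans (≤-reflexive (sym (*-identityˡ L))) (*-monoˡ-≤ L (1≤size (encStep (h [])))))
    (LEAF⇓ acc (a []) f (proj₁ (h [])) (proj₂ (h [])) (eq []))
  TABLE⇓ {suc j} (outside ∷ p) acc f h a eq = weaken
    (bound (size (encTable ∣ p ∣ encStep h)) (1≤size (encTable ∣ p ∣ encStep h)))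
    (case⇓₂ var⇓ (case⇓₁ var⇓
      (call⇓ (var⇓ ∷⇓ cons⇓ nil⇓ var⇓ ∷⇓ var⇓ ∷⇓ var⇓ ∷⇓ var⇓ ∷⇓ var⇓ ∷⇓ var⇓ ∷⇓ var⇓ ∷⇓ var⇓ ∷⇓ []⇓)
        (TABLE⇓ p (outside ∷ acc) f h a eq))))
    where
    eq′ : ∀ s j → s + s * j ≡ s * suc j
    eq′ = solve-∀
    bound : ∀ s → 1 ≤ s → 1 + s * (j + L) ≤ s * (suc j + L)
    bound s 1≤s = ≤-trans (+-monoˡ-≤ (s * (j + L)) 1≤s) (≤-reflexive (eq′ s (j + L)))
  TABLE⇓ {suc j} (inside ∷ p) acc f h a eq = weaken
    (bound (size (encTable ∣ p ∣ encStep (h ∘ (outside ∷_))))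
      (size (encTable ∣ p ∣ encStep (h ∘ (inside ∷_))))
      (1≤size (encTable ∣ p ∣ encStep (h ∘ (outside ∷_))))
      (1≤size (encTable ∣ p ∣ encStep (h ∘ (inside ∷_)))))
    (case⇓₂ var⇓ (case⇓₂ var⇓ (case⇓₂ var⇓ (cons⇓
      (call⇓ (var⇓ ∷⇓ cons⇓ nil⇓ var⇓ ∷⇓ var⇓ ∷⇓ var⇓ ∷⇓ var⇓ ∷⇓ var⇓ ∷⇓ var⇓ ∷⇓ var⇓ ∷⇓ var⇓ ∷⇓ []⇓)
        (TABLE⇓ p (outside ∷ acc) f (h ∘ (outside ∷_)) (a ∘ (outside ∷_)) (eq ∘ (outside ∷_))))
      (call⇓ (var⇓ ∷⇓ cons⇓ (cons⇓ nil⇓ nil⇓) var⇓ ∷⇓ var⇓ ∷⇓ var⇓ ∷⇓ var⇓ ∷⇓ var⇓ ∷⇓ var⇓ ∷⇓ var⇓ ∷⇓ var⇓ ∷⇓ []⇓)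
        (TABLE⇓ p (inside ∷ acc) f (h ∘ (inside ∷_)) (a ∘ (inside ∷_)) (eq ∘ (inside ∷_))))))))
    where
    eq′ : ∀ s t j → s + s * j + (t + t * j) + suc j ≡ suc (s + t) * suc j
    eq′ = solve-∀
    bound : ∀ s t → 1 ≤ s → 1 ≤ t → suc (s * (j + L)) + suc (t * (j + L)) ≤ suc (s + t) * (suc j + L)
    bound s t 1≤s 1≤t = ≤-trans
      (+-mono-≤ (+-monoˡ-≤ (s * (j + L)) 1≤s) (+-monoˡ-≤ (t * (j + L)) 1≤t))
      (slack (suc (j + L)) (eq′ s t (j + L)))

  ROWS⇓ : ∀ {n} f (h : Fin n → Sub Pin → Sub Pout × Fin states) t →
          encVec (encTable ∣ Pin ∣ encStep) (tabulate h) ∷ t ∷ encSubset Pin ∷ encSubset Pout ∷ encCoSafety φ ∷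
          encList (encVal φ) (vals φ) ∷ encList encBits (Monitor φ) ∷ encℕ states ∷ encBits f ∷ []
          ⊢ body ROWS ⇓ encOnto (encTable ∣ Pin ∣ encStep) (tabulate λ s I → target f (embed Pin I) (h s I)) t
          # size (encVec (encTable ∣ Pin ∣ encStep) (tabulate h)) * (2 + (k + L))
  ROWS⇓ {zero}  f h t = weaken z≤n (case⇓₁ var⇓ var⇓)
  ROWS⇓ {suc n} f h t = weaken
    (slack _ (eq (size (encTable ∣ Pin ∣ encStep (h zero)))
      (size (encVec (encTable ∣ Pin ∣ encStep) (tabulate (h ∘ suc)))) (k + L)))
    (case⇓₂ var⇓ (cons⇓
      (call⇓ (var⇓ ∷⇓ nil⇓ ∷⇓ var⇓ ∷⇓ var⇓ ∷⇓ var⇓ ∷⇓ var⇓ ∷⇓ var⇓ ∷⇓ var⇓ ∷⇓ var⇓ ∷⇓ []⇓)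
        (TABLE⇓ Pin [] f (h zero) (embed Pin) (λ _ → refl)))
      (call⇓ (var⇓ ∷⇓ var⇓ ∷⇓ var⇓ ∷⇓ var⇓ ∷⇓ var⇓ ∷⇓ var⇓ ∷⇓ var⇓ ∷⇓ var⇓ ∷⇓ var⇓ ∷⇓ []⇓)
        (ROWS⇓ f (h ∘ suc) t))))
    where
    eq : ∀ s t j → suc (s * j) + suc (t * (2 + j)) + (j + 2 * s) ≡ suc (s + t) * (2 + j)
    eq = solve-∀

  rows : Tree
  rows = encVec (encTable ∣ Pin ∣ encStep) (tabulate δ)

  TRANS⇓ : ∀ fs →
           encList encBits fs ∷ rows ∷ encSubset Pin ∷ encSubset Pout ∷ encCoSafety φ ∷
           encList (encVal φ) (vals φ) ∷ encList encBits (Monitor φ) ∷ encℕ states ∷ []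
           ⊢ body TRANS ⇓ blocks (encTable ∣ Pin ∣ encStep) (λ f s I → target f (embed Pin I) (δ s I)) fs
           # length fs * (2 + size rows * (2 + (k + L)))
  TRANS⇓ []       = case⇓₁ var⇓ nil⇓
  TRANS⇓ (f ∷ fs) = weaken
    (≤-reflexive (eq (length fs * (2 + size rows * (2 + (k + L)))) (size rows * (2 + (k + L)))))
    (case⇓₂ var⇓ (call⇓
      (var⇓ ∷⇓ call⇓ (var⇓ ∷⇓ var⇓ ∷⇓ var⇓ ∷⇓ var⇓ ∷⇓ var⇓ ∷⇓ var⇓ ∷⇓ var⇓ ∷⇓ var⇓ ∷⇓ []⇓) (TRANS⇓ fs) ∷⇓
       var⇓ ∷⇓ var⇓ ∷⇓ var⇓ ∷⇓ var⇓ ∷⇓ var⇓ ∷⇓ var⇓ ∷⇓ var⇓ ∷⇓ []⇓)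
      (ROWS⇓ f δ _)))
    where
    eq : ∀ c r → suc (suc c + 0 + r) ≡ 2 + r + c
    eq = solve-∀

  main⇓ : ∀ (γ : Assumption k) → encMealy C ∷ encAssumption γ ∷ encCoSafety φ ∷ [] ⊢ Program.main program ⇓
          encMealy product # totalCalls k l V S states (size rows)
  main⇓ γ = case⇓₂ var⇓ (case⇓₂ var⇓ (case⇓₂ var⇓ (case⇓₂ var⇓ (case⇓₂ var⇓
    (case⇓₂ (cons⇓ (call⇓ (var⇓ ∷⇓ []⇓) (VALS⇓ φ)) nil⇓)
    (case⇓₂ (cons⇓ (call⇓ (var⇓ ∷⇓ []⇓) (BITS⇓ (encVal φ) (vals φ))) nil⇓)
    (cons⇓ var⇓
    (cons⇓ var⇓
    (cons⇓ (call⇓ (var⇓ ∷⇓ var⇓ ∷⇓ []⇓) (COUNT⇓ (Monitor φ) states))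
    (cons⇓ (call⇓ (call⇓ (var⇓ ∷⇓ []⇓) (HEADS⇓ φ (vals φ)) ∷⇓ var⇓ ∷⇓ var⇓ ∷⇓ var⇓ ∷⇓ []⇓)
              (weaken index-bound (INDEX⇓ (initial∈Monitor φ) start)))
    (cons⇓ (convert (sym trans-blocks)
              (call⇓ (var⇓ ∷⇓ var⇓ ∷⇓ var⇓ ∷⇓ var⇓ ∷⇓ var⇓ ∷⇓ var⇓ ∷⇓ var⇓ ∷⇓ var⇓ ∷⇓ []⇓)
                (TRANS⇓ (Monitor φ))))
           (convert (sym final-blocks)
              (call⇓ (var⇓ ∷⇓ var⇓ ∷⇓ []⇓) (FINAL⇓ (Monitor φ) states))))))))))))))
    where
    index-bound : S * (2 * size (encBits (initial φ)) + states + 3) ≤ S * (2 * (1 + 4 * V) + states + 3)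
    index-bound = *-monoʳ-≤ S (+-monoˡ-≤ 3 (+-monoˡ-≤ states (*-monoʳ-≤ 2
      (subst (λ n → size (encBits (initial φ)) ≤ 1 + 4 * n) (length-map proj₁ (vals φ))
        (size-encBits (initial φ))))))

    monitorOf-combine′ : ∀ i s → monitorOf (combine i s) ≡ List.lookup (Monitor φ) i
    monitorOf-combine′ i s = cong (List.lookup (Monitor φ) ∘ proj₁) (remQuot-combine i s)

    trans-blocks : encVec (encTable ∣ Pin ∣ encStep) (tabulate (Mealy.trans product)) ≡
      blocks (encTable ∣ Pin ∣ encStep) (λ f s I → target f (embed Pin I) (δ s I)) (Monitor φ)
    trans-blocks = encVec-blocks _ _ (Monitor φ) (Mealy.trans product) λ i s →
      cong₂ (λ f s I → target f (embed Pin I) (δ s I)) (monitorOf-combine′ i s) (machineOf-combine i s)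

    final-blocks : encSubset (Mealy.final product) ≡
                   blocks {n = states} encBool (λ f _ → accepting f) (Monitor φ)
    final-blocks = encVec-blocks encBool _ (Monitor φ) (accepting ∘ monitorOf) λ i s →
      cong accepting (monitorOf-combine′ i s)

-- A polynomial bound on the number of calls

evaluate : List ℕ → ℕ → ℕ
evaluate []       b = 0
evaluate (c ∷ cs) b = c + b * evaluate cs b

-- For `b ≥ 1` every monomial is at most its coefficient times a common high power, so the
-- coefficients may simply be added.
evaluate≤ : ∀ cs {b} → 1 ≤ b → evaluate cs b ≤ sum cs * b ^ length cs
evaluate≤ []       1≤b = z≤n
evaluate≤ (c ∷ cs) {b} 1≤b = begin
  c + b * evaluate cs b
    ≤⟨ +-mono-≤ (m≤m*n c (b ^ suc (length cs))) (*-monoʳ-≤ b (evaluate≤ cs 1≤b)) ⟩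
  c * b ^ suc (length cs) + b * (sum cs * b ^ length cs)
    ≡⟨ eq c b (sum cs) (b ^ length cs) ⟩
  (c + sum cs) * b ^ suc (length cs)
    ∎
  where
  open ≤-Reasoning
  instance
    _ = >-nonZero (m^n>0 b {{>-nonZero 1≤b}} (suc (length cs)))
  eq : ∀ c b s p → c * (b * p) + b * (s * p) ≡ (c + s) * (b * p)
  eq = solve-∀

leafCalls-mono : ∀ {k l V S N b} → k ≤ b → l ≤ b → V ≤ b → S ≤ b → N ≤ b →
                 leafCalls k l V S N ≤ leafCalls b b b b b
leafCalls-mono k≤ l≤ V≤ S≤ N≤ = +-monoʳ-≤ 5 (+-mono-≤ (*-monoʳ-≤ 4 k≤) (+-mono-≤
  (*-mono-≤ V≤ (+-monoʳ-≤ 3 (+-mono-≤ (*-mono-≤ l≤ (+-monoʳ-≤ 4 k≤))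
    (*-mono-≤ V≤ (+-monoˡ-≤ 2 (*-monoʳ-≤ 2 (*-monoʳ-≤ 5 l≤)))))))
  (*-mono-≤ S≤ (+-monoˡ-≤ 3 (+-mono-≤ (*-monoʳ-≤ 2 (+-monoʳ-≤ 1 (*-monoʳ-≤ 4 V≤))) N≤)))))

totalCalls-mono : ∀ {k l V S N R b} → k ≤ b → l ≤ b → V ≤ b → S ≤ b → N ≤ b → R ≤ b →
                  totalCalls k l V S N R ≤ totalCalls b b b b b b
totalCalls-mono k≤ l≤ V≤ S≤ N≤ R≤ =
  +-mono-≤ (+-monoˡ-≤ 0 (s≤s (*-monoʳ-≤ 6 V≤)))
  (+-mono-≤ (+-monoˡ-≤ 0 (s≤s (*-monoʳ-≤ 8 S≤)))
  (+-mono-≤ (s≤s (*-mono-≤ S≤ (+-monoʳ-≤ 2 N≤)))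
  (+-mono-≤ (s≤s (+-mono-≤ (+-monoˡ-≤ 0 (s≤s V≤))
    (*-mono-≤ S≤ (+-monoˡ-≤ 3 (+-mono-≤ (*-monoʳ-≤ 2 (+-monoʳ-≤ 1 (*-monoʳ-≤ 4 V≤))) N≤)))))
  (+-mono-≤ (s≤s (*-mono-≤ S≤ (+-monoʳ-≤ 2 (*-mono-≤ R≤
    (+-monoʳ-≤ 2 (+-mono-≤ k≤ (leafCalls-mono k≤ l≤ V≤ S≤ N≤)))))))
  (s≤s (*-mono-≤ S≤ (+-monoʳ-≤ 2 N≤)))))))

-- The expansion of `totalCalls` with all parameters equal to `b`. Its coefficients sum to 90.
callCoefficients : List ℕ
callCoefficients = 7 ∷ 26 ∷ 18 ∷ 13 ∷ 15 ∷ 11 ∷ []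

totalCalls-polynomial : ∀ b → totalCalls b b b b b b ≡ evaluate callCoefficients b
totalCalls-polynomial b = eq b
  where
  eq : ∀ b → suc (6 * b) + 0 + (suc (8 * b) + 0 + (suc (b * (2 + b)) +
      (suc (suc b + 0 + b * (2 * (1 + 4 * b) + b + 3)) +
      (suc (b * (2 + b * (2 + (b + (5 + (4 * b + (b * (3 + (b * (4 + b) + b * (2 * (5 * b) + 2)))
        + b * (2 * (1 + 4 * b) + b + 3)))))))) + suc (b * (2 + b))))))
      ≡ 7 + b * (26 + b * (18 + b * (13 + b * (15 + b * (11 + b * 0)))))
  eq = solve-∀

-- Size of the encoded product

size-encℕ : ∀ n → size (encℕ n) ≡ 1 + 2 * n
size-encℕ zero    = refl
size-encℕ (suc n) = trans (cong (2 +_) (size-encℕ n)) (eq n)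
  where
  eq : ∀ n → 2 + (1 + 2 * n) ≡ 1 + 2 * suc n
  eq = solve-∀

size-encFin : ∀ {n} (i : Fin n) → size (encFin i) ≤ 1 + 2 * n
size-encFin i = ≤-trans (≤-reflexive (size-encℕ (toℕ i))) (s≤s (*-monoʳ-≤ 2 (<⇒≤ (toℕ<n i))))

size-encVec : ∀ {A : Set} {e : A → Tree} {M n} (h : Fin n → A) → (∀ i → size (e (h i)) ≤ M) →
              size (encVec e (tabulate h)) ≤ 1 + n * (1 + M)
size-encVec {n = zero}  h h≤ = ≤-refl
size-encVec {M = M} {suc n} h h≤ =
  ≤-trans (s≤s (+-mono-≤ (h≤ zero) (size-encVec (h ∘ suc) (h≤ ∘ suc)))) (≤-reflexive (eq M (n * (1 + M))))
  where
  eq : ∀ m c → suc (m + (1 + c)) ≡ 1 + (1 + m + c)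
  eq = solve-∀

size-∈encVec : ∀ {A : Set} (e : A → Tree) {n} (h : Fin n → A) i → size (e (h i)) ≤ size (encVec e (tabulate h))
size-∈encVec e h zero    = m≤n⇒m≤1+n (m≤m+n _ _)
size-∈encVec e h (suc i) = m≤n⇒m≤1+n (≤-trans (size-∈encVec e (h ∘ suc) i) (m≤n+m _ (size (e (h zero)))))

-- The factor is a successor so that it also covers the inner nodes, which both tables have in equal
-- number.
size-encTable : ∀ {A B : Set} {e : A → Tree} {e′ : B → Tree} K n (h : Subset n → A) (h′ : Subset n → B) →
                (∀ I → size (e′ (h′ I)) ≤ suc K * size (e (h I))) →
                size (encTable n e′ h′) ≤ suc K * size (encTable n e h)
size-encTable K zero    h h′ h≤ = h≤ []
size-encTable {e = e} K (suc n) h h′ h≤ = begin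
  suc (size (encTable n _ (h′ ∘ (outside ∷_))) + size (encTable n _ (h′ ∘ (inside ∷_))))
    ≤⟨ +-mono-≤ (m≤m+n 1 K) (+-mono-≤ (size-encTable K n _ _ (h≤ ∘ (outside ∷_)))
                                      (size-encTable K n _ _ (h≤ ∘ (inside ∷_)))) ⟩
  suc K + (suc K * x + suc K * y) ≡⟨ eq (suc K) x y ⟩
  suc K * suc (x + y)             ∎
  where
  open ≤-Reasoning
  x = size (encTable n e (h ∘ (outside ∷_)))
  y = size (encTable n e (h ∘ (inside ∷_)))
  eq : ∀ k x y → k + (k * x + k * y) ≡ k * suc (x + y)
  eq = solve-∀

n<2^n : ∀ n → n < 2 ^ n
n<2^n zero    = ≤-refl
n<2^n (suc n) = ≤-trans (+-mono-≤ (m^n>0 2 n) (n<2^n n)) (≤-reflexive (eq (2 ^ n)))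
  where
  eq : ∀ p → p + p ≡ 2 * p
  eq = solve-∀

-- A valuation has one bit per subformula, and each subformula accounts for at least one symbol.
length-vals≤ : ∀ {k} (φ : CoSafety k) → length (vals φ) ≤ 2 ^ lenCoSafety φ
length-vals≤ φ = subst (_≤ 2 ^ lenCoSafety φ) (sym (length-vals φ)) (rests≤ φ)
  where
  rests≤ : ∀ {k} (φ : CoSafety k) → 2 * length (rests φ) ≤ 2 ^ lenCoSafety φ

  pairs≤ : ∀ {k} (φ ψ : CoSafety k) → 2 * length (cartesianProduct (vals φ) (vals ψ)) ≤
           2 ^ suc (lenCoSafety φ + lenCoSafety ψ)
  pairs≤ φ ψ = *-monoʳ-≤ 2 (begin
    length (cartesianProduct (vals φ) (vals ψ)) ≡⟨ length-cartesianProductWith _,_ (vals φ) (vals ψ) ⟩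
    length (vals φ) * length (vals ψ)           ≡⟨ cong₂ _*_ (length-vals φ) (length-vals ψ) ⟩
    2 * length (rests φ) * (2 * length (rests ψ)) ≤⟨ *-mono-≤ (rests≤ φ) (rests≤ ψ) ⟩
    2 ^ lenCoSafety φ * 2 ^ lenCoSafety ψ       ≡⟨ sym (^-distribˡ-+-* 2 (lenCoSafety φ) (lenCoSafety ψ)) ⟩
    2 ^ (lenCoSafety φ + lenCoSafety ψ)         ∎)
    where open ≤-Reasoning

  rests≤ tt        = ≤-refl
  rests≤ ff        = ≤-refl
  rests≤ (atom e)  = ≤-refl
  rests≤ (¬atom e) = m≤m+n 2 2
  rests≤ (φ ∧ ψ)   = pairs≤ φ ψ
  rests≤ (φ ∨ ψ)   = pairs≤ φ ψ
  rests≤ (X φ)     = *-monoʳ-≤ 2 (subst (_≤ 2 ^ lenCoSafety φ) (sym (length-vals φ)) (rests≤ φ))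
  rests≤ (φ U ψ)   = pairs≤ φ ψ

data _⊑_ (s : Tree) : Tree → Set where
  here  : s ⊑ s
  left  : ∀ {t u} → s ⊑ t → s ⊑ (t ∙ u)
  right : ∀ {t u} → s ⊑ u → s ⊑ (t ∙ u)

size-⊑ : ∀ {s t} → s ⊑ t → size s ≤ size t
size-⊑ here                = ≤-refl
size-⊑ (left {t} {u} s⊑t)  = m≤n⇒m≤1+n (≤-trans (size-⊑ s⊑t) (m≤m+n (size t) (size u)))
size-⊑ (right {t} {u} s⊑u) = m≤n⇒m≤1+n (≤-trans (size-⊑ s⊑u) (m≤n+m (size u) (size t)))

n≤size-encSubset : ∀ {n} (p : Subset n) → n ≤ size (encSubset p)
n≤size-encSubset []      = z≤n
n≤size-encSubset (b ∷ p) = s≤s (≤-trans (n≤size-encSubset p) (m≤n+m _ (size (encBool b))))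

-- Follows the layout of `encMealy`: `P` bounds the two alphabets and `Q` is the number of states,
-- written in unary. Each of the `Q` rows is a row of `C`, of size at most `R`, inflated by
-- `1 + 2 * Q`.
outputSize : (P Q R : ℕ) → ℕ
outputSize P Q R = suc (P + suc (P + suc (1 + 2 * Q + suc (1 + 2 * Q +
  suc (1 + Q * (1 + (1 + 2 * Q) * R) + (1 + Q * (1 + 3)))))))

outputSize-mono : ∀ {P Q R b} → P ≤ b → Q ≤ b → R ≤ b → outputSize P Q R ≤ outputSize b b b
outputSize-mono P≤ Q≤ R≤ = s≤s (+-mono-≤ P≤ (s≤s (+-mono-≤ P≤ (s≤s (+-mono-≤ 2Q≤ (s≤s (+-mono-≤ 2Q≤
  (s≤s (+-mono-≤ (s≤s (*-mono-≤ Q≤ (s≤s (*-mono-≤ 2Q≤ R≤)))) (s≤s (*-monoˡ-≤ 4 Q≤)))))))))))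
  where 2Q≤ = s≤s (*-monoʳ-≤ 2 Q≤)

-- The zeros pad the list to the length of `callCoefficients`, so that time and size are both
-- estimated by `b ^ 6`; the sum is 23.
outputCoefficients : List ℕ
outputCoefficients = 9 ∷ 11 ∷ 1 ∷ 2 ∷ 0 ∷ 0 ∷ []

outputSize-polynomial : ∀ b → outputSize b b b ≡ evaluate outputCoefficients b
outputSize-polynomial b = eq b
  where
  eq : ∀ b → suc (b + suc (b + suc (1 + 2 * b + suc (1 + 2 * b +
       suc (1 + b * (1 + (1 + 2 * b) * b) + (1 + b * (1 + 3)))))))
       ≡ 9 + b * (11 + b * (1 + b * (2 + b * (0 + b * (0 + b * 0)))))
  eq = solve-∀

^-distribʳ-* : ∀ n a b → (a * b) ^ n ≡ a ^ n * b ^ n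
^-distribʳ-* zero    a b = refl
^-distribʳ-* (suc n) a b = trans (cong (a * b *_) (^-distribʳ-* n a b)) (eq a b (a ^ n) (b ^ n))
  where
  eq : ∀ a b p q → a * b * (p * q) ≡ a * p * (b * q)
  eq = solve-∀

-- The sixth power turns `2 ^ l` in the exponent into `6 * 2 ^ l`, which is at most `2 ^ (l + 3)`,
-- and `l + 3` fits below `c * l ^ c`. The factor `s ^ 6` stays outside the exponentials.
doublyExponential-bound : ∀ {c d s l} → d ≤ c → 6 ≤ c → 1 ≤ s → 1 ≤ l →
                          d * (s * 2 ^ 2 ^ l) ^ 6 ≤ doublyExponential c s l
doublyExponential-bound {c} {d} {s} {l} d≤c 6≤c 1≤s 1≤l = begin
  d * (s * 2 ^ 2 ^ l) ^ 6            ≡⟨ cong (d *_) (^-distribʳ-* 6 s (2 ^ 2 ^ l)) ⟩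
  d * (s ^ 6 * (2 ^ 2 ^ l) ^ 6)      ≡⟨ sym (*-assoc d (s ^ 6) _) ⟩
  d * s ^ 6 * (2 ^ 2 ^ l) ^ 6        ≡⟨ cong (d * s ^ 6 *_) (^-*-assoc 2 (2 ^ l) 6) ⟩
  d * s ^ 6 * 2 ^ (2 ^ l * 6)        ≤⟨ *-mono-≤ (*-mono-≤ d≤c (^-monoʳ-≤ s {{>-nonZero 1≤s}} 6≤c))
                                          (^-monoʳ-≤ 2 exponent) ⟩
  c * s ^ c * 2 ^ 2 ^ (c * l ^ c)    ∎
  where
  open ≤-Reasoning
  eq : ∀ l → 3 * l + l + 2 * l ≡ 6 * l
  eq = solve-∀
  l≤l^c : l ≤ l ^ c
  l≤l^c = ≤-trans (≤-reflexive (sym (^-identityʳ l)))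
            (^-monoʳ-≤ l {{>-nonZero 1≤l}} (≤-trans (m≤m+n 1 5) 6≤c))
  3+l≤ : l + 3 ≤ c * l ^ c
  3+l≤ = begin
    l + 3                ≡⟨ +-comm l 3 ⟩
    3 * 1 + l            ≤⟨ +-monoˡ-≤ l (*-monoʳ-≤ 3 1≤l) ⟩
    3 * l + l            ≤⟨ m≤m+n (3 * l + l) (2 * l) ⟩
    3 * l + l + 2 * l    ≡⟨ eq l ⟩
    6 * l                ≤⟨ *-mono-≤ 6≤c l≤l^c ⟩
    c * l ^ c            ∎
  exponent : 2 ^ l * 6 ≤ 2 ^ (c * l ^ c)
  exponent = begin
    2 ^ l * 6            ≤⟨ *-monoʳ-≤ (2 ^ l) (m≤m+n 6 2) ⟩
    2 ^ l * 2 ^ 3        ≡⟨ sym (^-distribˡ-+-* 2 l 3) ⟩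
    2 ^ (l + 3)          ≤⟨ ^-monoʳ-≤ 2 3+l≤ ⟩
    2 ^ (c * l ^ c)      ∎

module _ {k} {Pin Pout : Subset k} (γ : Assumption k) (φ : CoSafety k) (C : Mealy Pin Pout) where
  open Mealy C renaming (trans to δ)
  open Product φ C

  private
    s = size (encMealy C)
    l = ∣ γ ⟶ φ ∣
    -- The product of the two bounds and not their maximum, since it must also dominate the number
    -- `S * states` of product states.
    b = s * 2 ^ 2 ^ l
    S = length (Monitor φ)

    len≤l : lenCoSafety φ ≤ l
    len≤l = m≤n⇒m≤1+n (m≤n+m (lenCoSafety φ) (lenAssumption γ))

    1≤s : 1 ≤ s
    1≤s = 1≤size (encMealy C)

    s≤b : s ≤ b
    s≤b = m≤m*n s (2 ^ 2 ^ l) {{>-nonZero (m^n>0 2 (2 ^ l))}}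

    1≤b : 1 ≤ b
    1≤b = ≤-trans 1≤s s≤b

    E≤b : 2 ^ 2 ^ l ≤ b
    E≤b = m≤n*m (2 ^ 2 ^ l) s {{>-nonZero 1≤s}}

    2^l≤b : 2 ^ l ≤ b
    2^l≤b = ≤-trans (<⇒≤ (n<2^n (2 ^ l))) E≤b

    V≤2^l : length (vals φ) ≤ 2 ^ l
    V≤2^l = ≤-trans (length-vals≤ φ) (^-monoʳ-≤ 2 len≤l)

    S≤E : S ≤ 2 ^ 2 ^ l
    S≤E = ≤-trans (≤-reflexive (length-bits (vals φ))) (^-monoʳ-≤ 2 V≤2^l)

    pin≤s : size (encSubset Pin) ≤ s
    pin≤s = size-⊑ {t = encMealy C} (left here)

    pout≤s : size (encSubset Pout) ≤ s
    pout≤s = size-⊑ {t = encMealy C} (right (left here))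

    N≤s : states ≤ s
    N≤s = begin
      states             ≤⟨ m≤m+n states (states + 0) ⟩
      2 * states         ≤⟨ n≤1+n _ ⟩
      1 + 2 * states     ≡⟨ sym (size-encℕ states) ⟩
      size (encℕ states) ≤⟨ size-⊑ {t = encMealy C} (right (right (left here))) ⟩
      s                  ∎
      where open ≤-Reasoning

    R≤s : size (rows φ C) ≤ s
    R≤s = size-⊑ {t = encMealy C} (right (right (right (right (left here)))))

    SN≤b : S * states ≤ b
    SN≤b = ≤-trans (*-mono-≤ S≤E N≤s) (≤-reflexive (*-comm (2 ^ 2 ^ l) s))

  calls≤ : totalCalls k (lenCoSafety φ) (length (vals φ)) S states (size (rows φ C)) ≤ 90 * b ^ 6
  calls≤ = begin
    totalCalls k (lenCoSafety φ) (length (vals φ)) S states (size (rows φ C))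
      ≤⟨ totalCalls-mono (≤-trans (≤-trans (n≤size-encSubset Pin) pin≤s) s≤b)
           (≤-trans len≤l (≤-trans (<⇒≤ (n<2^n l)) 2^l≤b))
           (≤-trans V≤2^l 2^l≤b) (≤-trans S≤E E≤b) (≤-trans N≤s s≤b) (≤-trans R≤s s≤b) ⟩
    totalCalls b b b b b b       ≡⟨ totalCalls-polynomial b ⟩
    evaluate callCoefficients b  ≤⟨ evaluate≤ callCoefficients 1≤b ⟩
    90 * b ^ 6                   ∎
    where open ≤-Reasoning

  -- State numbers are unary, so an entry grows by at most `2 * (S * states)`; the multiplicative
  -- form is what `size-encTable` takes.
  size-target : ∀ f a r → size (encStep (target f a r)) ≤ suc (2 * (S * states)) * size (encStep r)
  size-target f a (O , q) = begin
    suc (size (encSubset O) + size (encFin q′))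
      ≤⟨ s≤s (+-monoʳ-≤ (size (encSubset O)) (size-encFin q′)) ⟩
    suc (size (encSubset O) + (1 + K))
      ≤⟨ s≤s (+-monoʳ-≤ (size (encSubset O)) (+-monoˡ-≤ K (1≤size (encFin q)))) ⟩
    suc (size (encSubset O) + (size (encFin q) + K))
      ≡⟨ cong suc (sym (+-assoc (size (encSubset O)) _ K)) ⟩
    size (encStep (O , q)) + K
      ≤⟨ +-monoʳ-≤ (size (encStep (O , q))) (m≤m*n K (size (encStep (O , q)))) ⟩
    size (encStep (O , q)) + K * size (encStep (O , q))
      ∎
    where
    open ≤-Reasoning
    K  = 2 * (S * states)
    q′ = proj₂ (target f a (O , q))

  size≤ : size (encMealy product) ≤ 23 * b ^ 6
  size≤ = begin
    size (encMealy product)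
      ≤⟨ s≤s (+-mono-≤ pin≤s (s≤s (+-mono-≤ pout≤s (s≤s (+-mono-≤ (≤-reflexive (size-encℕ (S * states)))
          (s≤s (+-mono-≤ (size-encFin (Mealy.start product)) (s≤s (+-mono-≤ table≤ final≤))))))))) ⟩
    outputSize s (S * states) (size (rows φ C))
      ≤⟨ outputSize-mono s≤b SN≤b (≤-trans R≤s s≤b) ⟩
    outputSize b b b               ≡⟨ outputSize-polynomial b ⟩
    evaluate outputCoefficients b  ≤⟨ evaluate≤ outputCoefficients 1≤b ⟩
    23 * b ^ 6                     ∎
    where
    open ≤-Reasoning
    table≤ : size (encVec (encTable ∣ Pin ∣ encStep) (tabulate (Mealy.trans product))) ≤
             1 + S * states * (1 + suc (2 * (S * states)) * size (rows φ C))
    table≤ = size-encVec (Mealy.trans product) λ q → ≤-trans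
      (size-encTable (2 * (S * states)) ∣ Pin ∣ (δ (machineOf q)) (Mealy.trans product q) λ I →
        size-target (monitorOf q) (embed Pin I) (δ (machineOf q) I))
      (*-monoʳ-≤ (suc (2 * (S * states))) (size-∈encVec (encTable ∣ Pin ∣ encStep) δ (machineOf q)))

    final≤ : size (encSubset (Mealy.final product)) ≤ 1 + S * states * (1 + 3)
    final≤ = size-encVec (accepting ∘ monitorOf) (size-encBool ∘ accepting ∘ monitorOf)

  -- The constant enters as a variable with two lower bounds, the one for the size and the other for
  -- the time, which keeps its numeral out of the powers.
  program-yields : ∀ {c} → 23 ≤ c → exprSize (Program.main program) + bodySize * 90 ≤ c →
    program on encMealy C ∷ encAssumption γ ∷ encCoSafety φ ∷ [] yields encMealy product
      within doublyExponential c s l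
  program-yields {c} 23≤c main≤c =
    let t , t≤ , d = time (main⇓ φ C γ)
    in (t , ≤-trans t≤ (≤-trans time≤ (doublyExponential-bound main≤c 6≤c 1≤s (s≤s z≤n))) , d) ,
       ≤-trans size≤ (doublyExponential-bound 23≤c 6≤c 1≤s (s≤s z≤n))
    where
    open ≤-Reasoning
    6≤c : 6 ≤ c
    6≤c = ≤-trans (m≤m+n 6 17) 23≤c
    eq : ∀ m k p → m * p + k * (90 * p) ≡ (m + k * 90) * p
    eq = solve-∀
    m = exprSize (Program.main program)
    n = totalCalls k (lenCoSafety φ) (length (vals φ)) S states (size (rows φ C))
    time≤ : m + bodySize * n ≤ (m + bodySize * 90) * b ^ 6
    time≤ = begin
      m + bodySize * n
        ≤⟨ +-mono-≤ (m≤m*n m (b ^ 6) {{>-nonZero (m^n>0 b {{>-nonZero 1≤b}} 6)}})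
                    (*-monoʳ-≤ bodySize calls≤) ⟩
      m * b ^ 6 + bodySize * (90 * b ^ 6)
        ≡⟨ eq m bodySize (b ^ 6) ⟩
      (m + bodySize * 90) * b ^ 6
        ∎

-- Abstract, lest the type checker unfold powers with this exponent.
abstract

  constant : ℕ
  constant = 23 + (exprSize (Program.main program) + bodySize * 90)

  23≤constant : 23 ≤ constant
  23≤constant = m≤m+n 23 (exprSize (Program.main program) + bodySize * 90)

  main≤constant : exprSize (Program.main program) + bodySize * 90 ≤ constant
  main≤constant = m≤n+m (exprSize (Program.main program) + bodySize * 90) 23

theorem3 : (∀ {k} (Pin Pout : Subset k) → Pin ∪ Pout ≡ ⊤ →
    (γ : Assumption k) (φ : CoSafety k) →
    TightlyRealisable Pin Pout γ φ ⇔ Realisable Pin Pout γ φ)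
    ×
    (Σ (Program 3) λ P → Σ ℕ λ c →
    ∀ {k} (Pin Pout : Subset k) → Pin ∪ Pout ≡ ⊤ →
    (γ : Assumption k) (φ : CoSafety k) →
    (C : Mealy Pin Pout) → C Realises γ ⟶ φ →
    Σ (Mealy Pin Pout) λ C′ →
    C′ TightlyRealises γ ⟶ φ ×
    P on encMealy C ∷ encAssumption γ ∷ encCoSafety φ ∷ [] yields encMealy C′
    within doublyExponential c (size (encMealy C)) ∣ γ ⟶ φ ∣)
theorem3 =
  (λ Pin Pout _ γ φ → mk⇔ (map₂ proj₁) λ (C , real) → Product.product φ C , product-tight γ φ C real) ,
  program , constant ,
  λ Pin Pout _ γ φ C real → Product.product φ C , product-tight γ φ C real ,
    program-yields γ φ C 23≤constant main≤constant
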